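{- Let $T$ be a triangulation of a convex $m$-gon ($m\ge2$) with vertices $1,\dots,m$ in cyclic order (indices modulo $m$), equipped with an admissible labelling. Then at least one of the following holds: (0) $m<4$, and the labelling is either empty or consists of a single triangle labelled $1$. (1) There is $k$ such that $(k-1,k,k+1)$ is a triangle of $T$ labelled $1$. Removing it yields an admissible labelling of a triangulation of an $(m-1)$-gon. (2) $m$ is odd, and there is $k$ such that the quadrilateral $(k-1,k,k+1,k+2)$ is a square of $T$ labelled $(c,-c)$. Removing it and multiplying all remaining labels by $-1$ yields an admissible labelling of a triangulation of an $(m-2)$-gon. (3) $m$ is even, and there is $k$ such that $(k-1,k,k+1)$ is a triangle labelled $-1$. Removing it and multiplying all remaining labels by $-1$ yields an admissible labelling of a triangulation of an $(m-1)$-gon. (4) There are $j,k$ with $|j-k|>1$ such that $(j-1,j,j+1,j+2)$ and $(k-1,k,k+1,k+2)$ are squares labelled $(c,-c)$ and $(d,-d)$. Removing both yields an admissible labelling of a triangulation of an $(m-4)$-gon. (5) There are $j,k$ with $|j-k|>1$ such that $(j-1,j,j+1)$ and $(k-1,k,k+1)$ are triangles labelled $-1$. Removing both yields an admissible labelling of a triangulation of an $(m-2)$-gon.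
   Context: A triangulation of an $m$-gon is a subdivision into $m-2$ triangles by non-crossing diagonals; for $m=2$ it has no triangles. A labelling assigns an integer $a_t$ to each triangle $t$. Let $d$ be the number of negative labels plus half the number of labels equal to $0$; if $d$ is an integer, the sign is $(-1)^d$. A labelling is admissible if: (i) the triangles $t$ with $a_t\notin\{1,-1\}$ are partitioned into two-element sets $\{t_1,t_2\}$ ("squares") of triangles sharing an edge with $a_{t_1}=-a_{t_2}$; (ii) $d$ is an even integer. A square "$(k-1,k,k+1,k+2)$ labelled $(c,-c)$" means a square of the admissible labelling whose two triangles together form the quadrilateral with vertices $k-1,k,k+1,k+2$, with labels $c$ and $-c$. Removing a triangle $(k-1,k,k+1)$ deletes vertex $k$; removing a square $(k-1,k,k+1,k+2)$ deletes vertices $k,k+1$. -}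

module Defs where

open import Data.Nat as ℕ using (ℕ; suc; _∸_)
open import Data.Nat.DivMod using (_mod_)
open import Data.Integer as ℤ using (ℤ; +_; 0ℤ; 1ℤ; -1ℤ; -_)
open import Data.Rational.Unnormalised as ℚᵘ using (ℚᵘ; _≃_; _/_)
open import Data.Fin using (Fin; toℕ; _<_)
open import Data.List using (List; []; _∷_; length; map; filter; _++_)
open import Data.List.Membership.Propositional using (_∈_; _∉_)
open import Data.List.Relation.Unary.Unique.Propositional using (Unique)
open import Data.List.Relation.Binary.BagAndSetEquality using (_∼[_]_; set)
open import Data.Product using (Σ; ∃; ∃!; ∃-syntax; _×_)
open import Data.Sum using (_⊎_)
open import Function.Bundles using (_⇔_)
open import Level using (0ℓ)
open import Relation.Binary using (Rel; Decidable; Symmetric)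
open import Relation.Binary.PropositionalEquality using (_≡_; _≢_)
open import Relation.Nullary using (¬_)

-- The vertices 1, …, m of the convex m-gon are the elements of Fin m, in
-- their natural (cyclic) order; succ and pred are k ↦ k+1 and k ↦ k-1 mod m.

succ : ∀ {m} → Fin m → Fin m
succ {suc n} k = suc (toℕ k) mod suc n

pred : ∀ {m} → Fin m → Fin m
pred {suc n} k = (toℕ k ℕ.+ n) mod suc n

Side : ∀ {m} → Rel (Fin m) 0ℓ
Side u v = v ≡ succ u ⊎ u ≡ succ v

-- |j - k| > 1, read modulo m.
Apart : ∀ {m} → Rel (Fin m) 0ℓ
Apart j k = j ≢ k × j ≢ succ k × k ≢ succ j

Edge : ∀ {m} → Rel (Fin m) 0ℓ → Rel (Fin m) 0ℓ
Edge D u v = Side u v ⊎ D u v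

-- A triangle cut out by a set D of non-crossing diagonals: three vertices
-- pairwise joined by sides or members of D.  No member of D can meet the
-- interior of such a triangle: it would have to cross one of the three edges.
-- Listing the vertices in increasing order, with irrelevant proofs, makes
-- _≡_ on triangles equality of their vertex sets.
record Triangle {m : ℕ} (D : Rel (Fin m) 0ℓ) : Set where
  constructor triangle
  field
    v₁ v₂ v₃ : Fin m
    .v₁<v₂ : v₁ < v₂
    .v₂<v₃ : v₂ < v₃
    .edge₁₂ : Edge D v₁ v₂
    .edge₂₃ : Edge D v₂ v₃
    .edge₁₃ : Edge D v₁ v₃

  corners : List (Fin m)
  corners = v₁ ∷ v₂ ∷ v₃ ∷ []

open Triangle public using (corners)

-- Having m - 2 triangles forces them to fill the m-gon: they have disjoint
-- interiors and their angles add up to those of the m-gon.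
record Triangulation (m : ℕ) : Set₁ where
  field
    m≥2         : 2 ℕ.≤ m
    Diagonal    : Rel (Fin m) 0ℓ
    diagonal?   : Decidable Diagonal
    symmetric   : Symmetric Diagonal
    proper      : ∀ {u v} → Diagonal u v → u ≢ v × ¬ Side u v
    noncrossing : ∀ {u v x y} → Diagonal u v → Diagonal x y →
                  ¬ (u < x × x < v × v < y)
    triangles   : List (Triangle Diagonal)
    unique      : Unique triangles
    complete    : ∀ t → t ∈ triangles
    count       : length triangles ≡ m ∸ 2

open Triangulation public using (triangles)

TriangleOf : ∀ {m} → Triangulation m → Set
TriangleOf T = Triangle (Triangulation.Diagonal T)

Labelling : ∀ {m} → Triangulation m → Set
Labelling T = TriangleOf T → ℤ

module _ {m : ℕ} (T : Triangulation m) (a : Labelling T) where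

  negatives zeros : ℕ
  negatives = length (filter (λ t → a t ℤ.<? 0ℤ) (triangles T))
  zeros     = length (filter (λ t → a t ℤ.≟ 0ℤ) (triangles T))

  d : ℚᵘ
  d = + negatives / 1 ℚᵘ.+ + zeros / 2

  record Admissible : Set₁ where
    field
      -- Square t u : {t , u} is a block of the partition.
      Square    : Rel (TriangleOf T) 0ℓ
      symmetric : Symmetric Square
      distinct  : ∀ {t u} → Square t u → t ≢ u
      nonunit   : ∀ {t u} → Square t u → a t ≢ 1ℤ × a t ≢ -1ℤ
      partition : ∀ t → a t ≢ 1ℤ → a t ≢ -1ℤ → ∃! _≡_ (Square t)
      adjacent  : ∀ {t u} → Square t u →
                  ∃[ x ] ∃[ y ] (x ≢ y × x ∈ corners t × y ∈ corners t
                                       × x ∈ corners u × y ∈ corners u)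
      opposite  : ∀ {t u} → Square t u → a t ≡ - a u
      d-even    : ∃[ e ] d ≃ (+ 2 ℤ.* e) / 1

open Admissible public using (Square)

module _ {m : ℕ} (T : Triangulation m) (a : Labelling T) where

  TriangleAt : Fin m → TriangleOf T → ℤ → Set
  TriangleAt k t c =
    corners t ∼[ set ] (pred k ∷ k ∷ succ k ∷ []) × a t ≡ c

  SquareAt : Admissible T a → Fin m → TriangleOf T → TriangleOf T → ℤ → Set
  SquareAt A k t u c =
    Square A t u
    × (corners t ++ corners u) ∼[ set ]
        (pred k ∷ k ∷ succ k ∷ succ (succ k) ∷ [])
    × a t ≡ c × a u ≡ - c

  -- (T′ , a′) is what is left of (T , a) once the given vertices and triangles
  -- are removed and f is applied to the remaining labels; ι is the
  -- order-preserving renumbering of the remaining vertices.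
  record IsRemoval (deleted : List (Fin m)) (removed : List (TriangleOf T))
                   (f : ℤ → ℤ) {m′ : ℕ} (T′ : Triangulation m′)
                   (a′ : Labelling T′) : Set where
    field
      ι             : Fin m′ → Fin m
      ι-increasing  : ∀ {i j} → i < j → ι i < ι j
      ι-image       : ∀ v → (∃[ i ] ι i ≡ v) ⇔ v ∉ deleted
      embed         : TriangleOf T′ → TriangleOf T
      embed-corners : ∀ t′ → corners (embed t′) ≡ map ι (corners t′)
      embed-image   : ∀ t → (∃[ t′ ] embed t′ ≡ t) ⇔ t ∉ removed
      labels        : ∀ t′ → a′ t′ ≡ f (a (embed t′))

  RemovalAdmissible : List (Fin m) → List (TriangleOf T) → (ℤ → ℤ) → ℕ → Set₁
  RemovalAdmissible deleted removed f m′ =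
    Σ (Triangulation m′) λ T′ → Σ (Labelling T′) λ a′ →
      IsRemoval deleted removed f T′ a′ × Admissible T′ a′

{-# OPTIONS --safe #-}
module Submission where

-- Contract the two triangles of every square in the dual tree of T.  For
-- m ≥ 4 the resulting tree has at least two nodes, since a single square gives
-- d = 1, so it has two leaves: triangles labelled ±1 or squares cut off by one
-- diagonal.  A leaf labelled 1 gives (1).  Otherwise each leaf contributes 1
-- to d, so removing two leaves preserves the parity of d, and since d plus the
-- d of the negated labelling is m - 2, removing one leaf and negating works
-- for a square if m is odd and for a triangle if m is even.
--
-- Leaves are found without tree surgery.  A triangle is determined by its
-- middle vertex, so by counting every vertex except the first and the last is
-- a middle vertex; hence every edge that is not of the form (k , k+1) joins
-- the first and last vertices of a triangle, and one descends along these triangles.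

open import Defs
open import Data.Nat using (ℕ; _∸_; _<_)
open import Data.Nat.Divisibility using (_∣_)
open import Data.Integer using (ℤ; 1ℤ; -1ℤ; -_)
open import Data.List using ([]; _∷_)
open import Data.Product using (∃-syntax; _×_)
open import Data.Sum using (_⊎_)
open import Function using (id)
open import Relation.Binary.PropositionalEquality using (_≡_)
open import Relation.Nullary using (¬_)

open import Data.Nat using (zero; suc; _+_; _*_; _≤_; z≤n; s≤s; _≤?_; _<?_)
open import Data.Nat.Properties
  using (≤-refl; ≤-trans; ≤-antisym; ≤-pred; ≤-reflexive; <-trans; <-≤-trans; ≤-<-trans; <⇒≤; <⇒≢; <-irrefl;
         <-asym; <⇒≱; ≮⇒≥; n≮0; n<1+n; n≤1+n; 1+n≰n; m≤m+n; m≤n⇒m<n∨m≡n; <-cmp; ≤∧≢⇒<; suc-injective; +-suc;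
         +-assoc; +-monoʳ-≤)
open import Data.Nat.DivMod using (_%_; m<n⇒m%n≡m; n%n≡0; [m+n]%n≡m%n)
open import Data.Nat.Divisibility using (divides; _∣?_; ∣m+n∣m⇒∣n; ∣m∣n⇒∣m+n; *-monoʳ-∣; ∣-refl)
open import Data.Nat.ListAction using (sum)
open import Data.Nat.ListAction.Properties using (sum-++; sum-↭)
open import Data.Nat.Tactic.RingSolver using (solve-∀)
open import Data.Integer as ℤ using (+_; -[1+_]; 0ℤ)
open import Data.Integer.Properties as ℤₚ using (neg-involutive; pos-*; pos-+; abs-*)
open import Data.Rational.Unnormalised using (_≃_; *≡*) renaming (_/_ to _/ᵘ_)
open import Data.Fin as Fin using (Fin; toℕ; fromℕ; fromℕ<; punchIn)
open import Data.Fin.Properties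
  using (toℕ-fromℕ; toℕ-fromℕ<; toℕ<n; toℕ-injective; punchInᵢ≢i; punchIn-injective; punchIn-mono-≤;
         punchIn-cancel-≤; punchIn-punchOut)
open import Data.List using (List; _++_; length; map; filter; allFin)
open import Data.List.Properties
  using (length-map; length-tabulate; map-++; map-∘; map-id; ∷-injectiveˡ; ∷-injectiveʳ)
open import Data.List.Membership.Propositional using (_∈_; _∉_)
open import Data.List.Membership.Propositional.Properties
  using (∈-∃++; ∈-++⁺ˡ; ∈-++⁺ʳ; ∈-++⁻; ∈-map⁻; ∈-allFin)
open import Data.List.Relation.Unary.Any using (here; there)
open import Data.List.Relation.Unary.All as All using (All; []; _∷_)
import Data.List.Relation.Unary.All.Properties as All
open import Data.List.Relation.Unary.AllPairs as AllPairs using ([]; _∷_)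
open import Data.List.Relation.Unary.Unique.Propositional using (Unique)
import Data.List.Relation.Unary.Unique.Propositional.Properties as Unique
open import Data.List.Relation.Binary.BagAndSetEquality using (_∼[_]_; set)
open import Data.List.Relation.Binary.Disjoint.Propositional using (Disjoint)
open import Data.List.Relation.Binary.Subset.Propositional using (_⊆_)
open import Data.List.Relation.Binary.Permutation.Propositional using (_↭_; ↭⇒↭ₛ; ↭-trans; ↭-reflexive; prep)
open import Data.List.Relation.Binary.Permutation.Propositional.Properties as Perm
  using (∈-resp-↭; ↭-length; shift; ++⁺ˡ)
import Data.List.Relation.Binary.Permutation.Setoid.Properties as PermS
open import Data.Product using (Σ; ∃₂; _,_; proj₁; proj₂)
open import Data.Sum using (inj₁; inj₂; [_,_]′; swap)
open import Data.Empty using (⊥; ⊥-elim)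
open import Function using (_∘_)
open import Level using (0ℓ)
open import Function.Bundles using (mk⇔)
open import Relation.Binary using (Rel; tri<; tri≈; tri>)
open import Relation.Binary.PropositionalEquality
  using (_≢_; refl; sym; trans; cong; cong₂; subst; subst₂; setoid)
open import Relation.Nullary using (Dec; yes; no; contradiction)
open import Relation.Nullary.Decidable using (recompute; from-no; ¬?; _⊎-dec_; _×-dec_)
open Triangle using (v₁; v₂; v₃)

-- Lists and the cyclic order of the vertices

-- The conclusions remove up to four vertices, but a triangulation is only ever shrunk by one tip at
-- a time: in a square, the second triangle acquires a tip only once the first is gone. Working in
-- the intermediate polygons would mean proving again, for renumbered vertices, that the other leaf
-- is still a leaf. Adjacency after deletion is therefore expressed by `Adj` in the original
-- polygon, and a leaf disjoint from the removed triangles keeps all its corners. The half-integer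
-- `d` is replaced by the natural number `2d`, so that `d` is even exactly when 4 divides it.
-- Opposite labels together weigh 2. This one identity explains why a square contributes 1 whatever
-- its label, 0 included, and why `d` and its negated version add up to the number of triangles.
-- Rooting the dual tree at the side joining the first and last vertices turns subtrees into
-- intervals, so that disjointness of leaves is a comparison of endpoints. The price is that a leaf
-- containing the root wraps around the end of the numbering and has to be rotated.

∈⇒↭ : ∀ {A : Set} {x : A} {xs} → x ∈ xs → ∃[ ys ] xs ↭ x ∷ ys
∈⇒↭ {x = x} x∈ with ys , zs , refl ← ∈-∃++ x∈ = ys ++ zs , shift x ys zs

-- Pigeonhole: each entry of `xs` strikes out its own entry of `ys`, and the length bound leaves
-- nothing over.
unique∧⊆⇒⊇ : ∀ {A : Set} {xs ys : List A} → Unique xs → xs ⊆ ys → length ys ≤ length xs → ys ⊆ xs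
unique∧⊆⇒⊇ {ys = []} [] _ _ ()
unique∧⊆⇒⊇ {xs = x ∷ xs} {ys} (x∉ ∷ u) s le v∈ with zs , p ← ∈⇒↭ (s (here refl)) = go (∈-resp-↭ p v∈)
  where
  s′ : xs ⊆ zs
  s′ w∈ with ∈-resp-↭ p (s (there w∈))
  ... | here refl = contradiction refl (All.lookup x∉ w∈)
  ... | there w∈′ = w∈′
  go : ∀ {v} → v ∈ x ∷ zs → v ∈ x ∷ xs
  go (here e) = here e
  go (there v∈) = there (unique∧⊆⇒⊇ u s′ (≤-pred (subst (_≤ _) (↭-length p) le)) v∈)

-- The graph of `succ` on numbers; wrapping around becomes a case distinction instead of a
-- remainder.
Next : ℕ → ℕ → ℕ → Set
Next n i j = j ≡ suc i ⊎ (i ≡ n × j ≡ 0)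

next-succ : ∀ {n} (u : Fin (suc n)) → Next n (toℕ u) (toℕ (succ u))
next-succ {n} u with suc (toℕ u) ≤? n
... | yes q = inj₁ (trans (toℕ-fromℕ< _) (m<n⇒m%n≡m (s≤s q)))
... | no q = inj₂ (u≡n , trans (toℕ-fromℕ< _) (trans (cong (λ x → suc x % suc n) u≡n) (n%n≡0 (suc n))))
  where
  u≡n = ≤-antisym (≤-pred (toℕ<n u)) (≮⇒≥ q)

next-functional : ∀ {n i j k} → j ≤ n → k ≤ n → Next n i j → Next n i k → j ≡ k
next-functional _ _ (inj₁ refl) (inj₁ refl) = refl
next-functional le _ (inj₁ refl) (inj₂ (refl , _)) = contradiction le 1+n≰n
next-functional _ le (inj₂ (refl , _)) (inj₁ refl) = contradiction le 1+n≰n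
next-functional _ _ (inj₂ (_ , refl)) (inj₂ (_ , refl)) = refl

next-injective : ∀ {n i j k} → Next n i k → Next n j k → i ≡ j
next-injective (inj₁ refl) (inj₁ refl) = refl
next-injective (inj₂ (refl , _)) (inj₂ (refl , _)) = refl
next-injective (inj₁ refl) (inj₂ (_ , ()))
next-injective (inj₂ (_ , refl)) (inj₁ ())

toℕ≤ : ∀ {n} (u : Fin (suc n)) → toℕ u ≤ n
toℕ≤ u = ≤-pred (toℕ<n u)

next⇒succ : ∀ {n} {u v : Fin (suc n)} → Next n (toℕ u) (toℕ v) → v ≡ succ u
next⇒succ {u = u} {v} p = toℕ-injective (next-functional (toℕ≤ v) (toℕ≤ (succ u)) p (next-succ u))

succ⇒next : ∀ {n} {u v : Fin (suc n)} → v ≡ succ u → Next n (toℕ u) (toℕ v)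
succ⇒next {u = u} refl = next-succ u

succ-injective : ∀ {m} {u v : Fin m} → succ u ≡ succ v → u ≡ v
succ-injective {suc n} {u} {v} e =
  toℕ-injective (next-injective (next-succ u) (subst (Next n (toℕ v) ∘ toℕ) (sym e) (next-succ v)))

pred-succ : ∀ {m} (u : Fin m) → pred (succ u) ≡ u
pred-succ {suc n} u = toℕ-injective (trans (toℕ-fromℕ< _) (go (next-succ u)))
  where
  go : ∀ {j} → Next n (toℕ u) j → (j + n) % suc n ≡ toℕ u
  go (inj₁ refl) = trans (cong (_% suc n) (sym (+-suc (toℕ u) n)))
                     (trans ([m+n]%n≡m%n (toℕ u) (suc n)) (m<n⇒m%n≡m (toℕ<n u)))
  go (inj₂ (u≡n , refl)) = trans (m<n⇒m%n≡m (n<1+n n)) (sym u≡n)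

side-step : ∀ {m} {u v : Fin m} → toℕ v ≡ suc (toℕ u) → v ≡ succ u
side-step {suc n} e = next⇒succ (inj₁ e)

side? : ∀ {m} (u v : Fin m) → Dec (Side u v)
side? u v = (v Fin.≟ succ u) ⊎-dec (u Fin.≟ succ v)

side-< : ∀ {n} {u v : Fin (suc n)} → Side u v → u Fin.< v → toℕ v ≡ suc (toℕ u) ⊎ (toℕ u ≡ 0 × toℕ v ≡ n)
side-< (inj₁ e) lt with succ⇒next e
... | inj₁ p = inj₁ p
... | inj₂ (_ , v≡0) = contradiction (subst (_ <_) v≡0 lt) λ ()
side-< {v = v} (inj₂ e) lt with succ⇒next e
... | inj₁ p = contradiction (subst (toℕ v <_) (sym p) (n<1+n _)) (<-asym lt)
... | inj₂ (v≡n , u≡0) = inj₂ (u≡0 , v≡n)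

-- Sides are undirected, so a tip may be met in either direction. If both sides ran the same way,
-- `p` and `s` would coincide.
neighbours : ∀ {m} {p k s : Fin m} → Side p k → Side k s → p ≢ s →
             (k ≡ succ p × s ≡ succ k) ⊎ (k ≡ succ s × p ≡ succ k)
neighbours (inj₁ a) (inj₁ b) _ = inj₁ (a , b)
neighbours (inj₁ a) (inj₂ b) ne = contradiction (succ-injective (trans (sym a) b)) ne
neighbours (inj₂ a) (inj₁ b) ne = contradiction (trans a (sym b)) ne
neighbours (inj₂ a) (inj₂ b) _ = inj₂ (b , a)

<-suc-suc : ∀ {i j l} → l ≡ suc j → j ≡ suc i → i < l
<-suc-suc refl refl = <-trans (n<1+n _) (n<1+n _)

module _ {n} (k : Fin (suc n)) where

  punchIn-cases : ∀ (i : Fin n) → (toℕ i < toℕ k × toℕ (punchIn k i) ≡ toℕ i)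
                              ⊎ (toℕ k ≤ toℕ i × toℕ (punchIn k i) ≡ suc (toℕ i))
  punchIn-cases = go k
    where
    go : ∀ {n} (k : Fin (suc n)) (i : Fin n) → (toℕ i < toℕ k × toℕ (punchIn k i) ≡ toℕ i)
                              ⊎ (toℕ k ≤ toℕ i × toℕ (punchIn k i) ≡ suc (toℕ i))
    go Fin.zero i = inj₂ (z≤n , refl)
    go (Fin.suc k) Fin.zero = inj₁ (s≤s z≤n , refl)
    go (Fin.suc k) (Fin.suc i) with go k i
    ... | inj₁ (lt , e) = inj₁ (s≤s lt , cong suc e)
    ... | inj₂ (le , e) = inj₂ (s≤s le , cong suc e)

  punchIn-mono-< : ∀ {i j} → i Fin.< j → punchIn k i Fin.< punchIn k j
  punchIn-mono-< {i} {j} lt =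
    ≤∧≢⇒< (punchIn-mono-≤ k i j (<⇒≤ lt)) (λ e → <⇒≢ lt (cong toℕ (punchIn-injective k i j (toℕ-injective e))))

  punchIn-cancel-< : ∀ {i j} → punchIn k i Fin.< punchIn k j → i Fin.< j
  punchIn-cancel-< {i} {j} lt =
    ≤∧≢⇒< (punchIn-cancel-≤ k i j (<⇒≤ lt)) (λ e → <⇒≢ lt (cong (toℕ ∘ punchIn k) (toℕ-injective e)))

module _ {n} (k : Fin (suc (suc n))) where

  private
    ι = punchIn k

  succ-punchIn⁻ : ∀ {i j} → ι j ≡ succ (ι i) → j ≡ succ i
  succ-punchIn⁻ {i} {j} e with succ⇒next e | punchIn-cases k i | punchIn-cases k j
  ... | inj₁ q | inj₁ (_ , a) | inj₁ (_ , b) = next⇒succ (inj₁ (trans (sym b) (trans q (cong suc a))))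
  ... | inj₁ q | inj₁ (lt , a) | inj₂ (le , b) =
    contradiction (subst (toℕ k ≤_) (suc-injective (trans (sym b) (trans q (cong suc a)))) le) (<⇒≱ lt)
  ... | inj₁ q | inj₂ (le , a) | inj₁ (lt , b) =
    contradiction (≤-trans le (<⇒≤ (<-suc-suc (trans (sym b) q) a))) (<⇒≱ lt)
  ... | inj₁ q | inj₂ (_ , a) | inj₂ (_ , b) =
    next⇒succ (inj₁ (trans (suc-injective (trans (sym b) q)) a))
  ... | inj₂ (p , q) | inj₁ (_ , a) | _ = contradiction (trans (sym a) p) (<⇒≢ (toℕ<n i))
  ... | inj₂ (p , q) | inj₂ (_ , a) | inj₁ (_ , b) =
    next⇒succ (inj₂ (suc-injective (trans (sym a) p) , trans (sym b) q))
  ... | inj₂ (p , q) | inj₂ (_ , a) | inj₂ (_ , b) = contradiction (trans (sym b) q) λ ()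

  side-punchIn⁻ : ∀ {i j} → Side (ι i) (ι j) → Side i j
  side-punchIn⁻ (inj₁ e) = inj₁ (succ-punchIn⁻ e)
  side-punchIn⁻ (inj₂ e) = inj₂ (succ-punchIn⁻ e)

  succ-skip : ∀ {i j} → k ≡ succ (ι i) → ι j ≡ succ k → j ≡ succ i
  succ-skip {i} {j} e f with succ⇒next e | succ⇒next f | punchIn-cases k i | punchIn-cases k j
  ... | inj₁ p | inj₁ q | inj₁ (_ , a) | inj₂ (_ , b) =
    next⇒succ (inj₁ (trans (suc-injective (trans (sym b) q)) (trans p (cong suc a))))
  ... | inj₁ p | inj₁ q | inj₂ (le , a) | _ = contradiction le (<⇒≱ (<-suc-suc p a))
  ... | inj₁ p | inj₁ q | _ | inj₁ (lt , b) =
    contradiction (<-trans lt (subst (toℕ k <_) (trans (sym q) b) (n<1+n _))) (<-irrefl refl)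
  ... | inj₁ p | inj₂ (q , r) | inj₁ (_ , a) | inj₁ (_ , b) =
    next⇒succ (inj₂ (trans (sym a) (suc-injective (trans (sym p) q)) , trans (sym b) r))
  ... | inj₁ p | inj₂ (q , r) | inj₂ (le , a) | _ = contradiction le (<⇒≱ (<-suc-suc p a))
  ... | inj₁ p | inj₂ (q , r) | _ | inj₂ (_ , b) = contradiction (trans (sym b) r) λ ()
  ... | inj₂ (p , q) | inj₁ r | inj₁ (_ , a) | _ = contradiction (trans (sym a) p) (<⇒≢ (toℕ<n i))
  ... | inj₂ (p , q) | inj₁ r | inj₂ (_ , a) | inj₁ (lt , b) = contradiction (subst (toℕ j <_) q lt) λ ()
  ... | inj₂ (p , q) | inj₁ r | inj₂ (_ , a) | inj₂ (_ , b) =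
    next⇒succ (inj₂ (suc-injective (trans (sym a) p) , trans (suc-injective (trans (sym b) r)) q))
  ... | inj₂ (p , q) | inj₂ (r , s) | _ | _ = contradiction (trans (sym q) r) λ ()

  side-skip : ∀ {i j} → Side (ι i) k → Side k (ι j) → ι i ≢ ι j → Side i j
  side-skip p s ne with neighbours p s ne
  ... | inj₁ (a , b) = inj₁ (succ-skip a b)
  ... | inj₂ (a , b) = inj₂ (succ-skip a b)

  -- The second alternative is the one new side, bridging the gap left by `k`; `succ-skip` is its
  -- converse.
  succ-punchIn⁺ : ∀ {i j} → j ≡ succ i → ι j ≡ succ (ι i) ⊎ (k ≡ succ (ι i) × ι j ≡ succ k)
  succ-punchIn⁺ {i} {j} e with succ⇒next e | punchIn-cases k i | punchIn-cases k j
  ... | inj₁ q | inj₁ (_ , a) | inj₁ (_ , b) = inj₁ (next⇒succ (inj₁ (trans b (trans q (cong suc (sym a))))))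
  ... | inj₁ q | inj₁ (lt , a) | inj₂ (le , b) = inj₂ (next⇒succ (inj₁ (trans k≡ (cong suc (sym a)))) ,
                                                       next⇒succ (inj₁ (trans b (cong suc (trans q (sym k≡))))))
    where k≡ = ≤-antisym (subst (toℕ k ≤_) q le) lt
  ... | inj₁ q | inj₂ (le , a) | inj₁ (lt , b) =
    contradiction (≤-trans le (subst (toℕ i ≤_) (sym q) (n≤1+n _))) (<⇒≱ lt)
  ... | inj₁ q | inj₂ (_ , a) | inj₂ (_ , b) = inj₁ (next⇒succ (inj₁ (trans b (cong suc (trans q (sym a))))))
  ... | inj₂ (p , q) | inj₁ (lt , a) | inj₁ (_ , b) =
    inj₂ (next⇒succ (inj₁ (trans k≡ (cong suc (trans (sym p) (sym a))))) , next⇒succ (inj₂ (k≡ , trans b q)))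
    where k≡ = ≤-antisym (toℕ≤ k) (subst (_< toℕ k) p lt)
  ... | inj₂ (p , q) | inj₁ (lt , a) | inj₂ (le , b) =
    contradiction (subst (toℕ k ≤_) q le) (<⇒≱ (≤-<-trans z≤n lt))
  ... | inj₂ (p , q) | inj₂ (le , a) | inj₁ (lt , b) =
    inj₁ (next⇒succ (inj₂ (trans a (cong suc p) , trans b q)))
  ... | inj₂ (p , q) | inj₂ (le , a) | inj₂ (le′ , b) =
    inj₂ (next⇒succ (inj₂ (trans a (cong suc p) , k≡0)) , next⇒succ (inj₁ (trans b (cong suc (trans q (sym k≡0))))))
    where k≡0 = ≤-antisym (subst (toℕ k ≤_) q le′) z≤n

-- Triangles and edges

triangle-≡ : ∀ {m} {D : Rel (Fin m) 0ℓ} {t u : Triangle D} → v₁ t ≡ v₁ u → v₂ t ≡ v₂ u → v₃ t ≡ v₃ u → t ≡ u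
triangle-≡ {t = triangle _ _ _ _ _ _ _ _} {triangle _ _ _ _ _ _ _ _} refl refl refl = refl

module _ {m} {D : Rel (Fin m) 0ℓ} where

  v₁<v₂ : (t : Triangle D) → toℕ (v₁ t) < toℕ (v₂ t)
  v₁<v₂ (triangle _ _ _ p _ _ _ _) = recompute (_ <? _) p

  v₂<v₃ : (t : Triangle D) → toℕ (v₂ t) < toℕ (v₃ t)
  v₂<v₃ (triangle _ _ _ _ p _ _ _) = recompute (_ <? _) p

  v₁<v₃ : (t : Triangle D) → toℕ (v₁ t) < toℕ (v₃ t)
  v₁<v₃ t = <-trans (v₁<v₂ t) (v₂<v₃ t)

  data Pair (t : Triangle D) (x y : Fin m) : Set where
    pair₁₂ : x ≡ v₁ t → y ≡ v₂ t → Pair t x y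
    pair₂₃ : x ≡ v₂ t → y ≡ v₃ t → Pair t x y
    pair₁₃ : x ≡ v₁ t → y ≡ v₃ t → Pair t x y

  pair : ∀ t {x y} → x ∈ corners t → y ∈ corners t → x Fin.< y → Pair t x y
  pair t (here refl) (here refl) lt = contradiction lt (<-irrefl refl)
  pair t (here refl) (there (here refl)) lt = pair₁₂ refl refl
  pair t (here refl) (there (there (here refl))) lt = pair₁₃ refl refl
  pair t (there (here refl)) (here refl) lt = contradiction lt (<-asym (v₁<v₂ t))
  pair t (there (here refl)) (there (here refl)) lt = contradiction lt (<-irrefl refl)
  pair t (there (here refl)) (there (there (here refl))) lt = pair₂₃ refl refl
  pair t (there (there (here refl))) (here refl) lt = contradiction lt (<-asym (v₁<v₃ t))
  pair t (there (there (here refl))) (there (here refl)) lt = contradiction lt (<-asym (v₂<v₃ t))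
  pair t (there (there (here refl))) (there (there (here refl))) lt = contradiction lt (<-irrefl refl)

  corners-unique : (t : Triangle D) → Unique (corners t)
  corners-unique t = ((λ e → <⇒≢ (v₁<v₂ t) (cong toℕ e)) ∷ (λ e → <⇒≢ (v₁<v₃ t) (cong toℕ e)) ∷ [])
                   ∷ ((λ e → <⇒≢ (v₂<v₃ t) (cong toℕ e)) ∷ []) ∷ [] ∷ []

  -- Corners are listed in increasing order, so of the nine placements of the two consecutive pairs
  -- only `pair₁₂` followed by `pair₂₃` agrees on the middle corner.
  corners-⊆⇒≡ : ∀ {t u : Triangle D} → corners t ⊆ corners u → t ≡ u
  corners-⊆⇒≡ {t} {u} s
    with pair u (s (here refl)) (s (there (here refl))) (v₁<v₂ t)
       | pair u (s (there (here refl))) (s (there (there (here refl)))) (v₂<v₃ t)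
  ... | pair₁₂ a b | pair₁₂ c _ = contradiction (cong toℕ (trans (sym c) b)) (<⇒≢ (v₁<v₂ u))
  ... | pair₁₂ a b | pair₂₃ c d = triangle-≡ a b d
  ... | pair₁₂ a b | pair₁₃ c _ = contradiction (cong toℕ (trans (sym c) b)) (<⇒≢ (v₁<v₂ u))
  ... | pair₂₃ a b | pair₁₂ c _ = contradiction (cong toℕ (trans (sym c) b)) (<⇒≢ (v₁<v₃ u))
  ... | pair₂₃ a b | pair₂₃ c _ = contradiction (cong toℕ (trans (sym c) b)) (<⇒≢ (v₂<v₃ u))
  ... | pair₂₃ a b | pair₁₃ c _ = contradiction (cong toℕ (trans (sym c) b)) (<⇒≢ (v₁<v₃ u))
  ... | pair₁₃ a b | pair₁₂ c _ = contradiction (cong toℕ (trans (sym c) b)) (<⇒≢ (v₁<v₃ u))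
  ... | pair₁₃ a b | pair₂₃ c _ = contradiction (cong toℕ (trans (sym c) b)) (<⇒≢ (v₂<v₃ u))
  ... | pair₁₃ a b | pair₁₃ c _ = contradiction (cong toℕ (trans (sym c) b)) (<⇒≢ (v₁<v₃ u))

module Geometry {n} (T : Triangulation (suc n)) where
  open Triangulation T using (Diagonal; diagonal?; symmetric; noncrossing; unique; complete; count)

  E : Rel (Fin (suc n)) 0ℓ
  E = Edge Diagonal

  edge? : ∀ u v → Dec (E u v)
  edge? u v = side? u v ⊎-dec diagonal? u v

  edge-sym : ∀ {u v} → E u v → E v u
  edge-sym (inj₁ s) = inj₁ (swap s)
  edge-sym (inj₂ d) = inj₂ (symmetric d)

  e₁₂ : (t : TriangleOf T) → E (v₁ t) (v₂ t)
  e₁₂ (triangle _ _ _ _ _ p _ _) = recompute (edge? _ _) p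

  e₂₃ : (t : TriangleOf T) → E (v₂ t) (v₃ t)
  e₂₃ (triangle _ _ _ _ _ _ p _) = recompute (edge? _ _) p

  e₁₃ : (t : TriangleOf T) → E (v₁ t) (v₃ t)
  e₁₃ (triangle _ _ _ _ _ _ _ p) = recompute (edge? _ _) p

  -- Sides cross nothing: no vertex lies strictly between two consecutive ones, and none lies
  -- outside the interval from first to last.
  edge-noncrossing : ∀ {u v x y} → E u v → E x y → u Fin.< x → x Fin.< v → v Fin.< y → ⊥
  edge-noncrossing (inj₁ s) _ a b c with side-< s (<-trans a b)
  ... | inj₁ e = <⇒≱ b (subst (_≤ _) (sym e) a)
  ... | inj₂ (_ , e) = <⇒≱ c (subst (_ ≤_) (sym e) (toℕ≤ _))
  edge-noncrossing (inj₂ _) (inj₁ s) a b c with side-< s (<-trans b c)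
  ... | inj₁ e = <⇒≱ c (subst (_≤ _) (sym e) b)
  ... | inj₂ (e , _) = n≮0 (subst (_ <_) e a)
  edge-noncrossing (inj₂ d) (inj₂ d′) a b c = noncrossing d d′ (a , b , c)

  pair-edge : ∀ t {x y} → Pair t x y → E x y
  pair-edge t (pair₁₂ refl refl) = e₁₂ t
  pair-edge t (pair₂₃ refl refl) = e₂₃ t
  pair-edge t (pair₁₃ refl refl) = e₁₃ t

  corner-edge : ∀ t {x y} → x ∈ corners t → y ∈ corners t → x ≢ y → E x y
  corner-edge t {x} {y} p q ne with <-cmp (toℕ x) (toℕ y)
  ... | tri< lt _ _ = pair-edge t (pair t p q lt)
  ... | tri≈ _ e _ = contradiction (toℕ-injective e) ne
  ... | tri> _ _ gt = edge-sym (pair-edge t (pair t q p gt))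

  -- If the first vertices differ, the edge from the smaller one to the common middle crosses the
  -- long edge of the other triangle. If only the last vertices differ, the long edge of the
  -- triangle that ends earlier crosses the second edge of the other.
  v₂-injective : ∀ t u → v₂ t ≡ v₂ u → t ≡ u
  v₂-injective t u e with <-cmp (toℕ (v₁ t)) (toℕ (v₁ u)) | <-cmp (toℕ (v₃ t)) (toℕ (v₃ u))
  ... | tri< lt _ _ | _ = ⊥-elim (edge-noncrossing (e₁₂ t) (e₁₃ u) lt
          (subst (λ z → toℕ (v₁ u) < toℕ z) (sym e) (v₁<v₂ u)) (subst (λ z → toℕ z < toℕ (v₃ u)) (sym e) (v₂<v₃ u)))
  ... | tri> _ _ gt | _ = ⊥-elim (edge-noncrossing (e₁₂ u) (e₁₃ t) gt
          (subst (λ z → toℕ (v₁ t) < toℕ z) e (v₁<v₂ t)) (subst (λ z → toℕ z < toℕ (v₃ t)) e (v₂<v₃ t)))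
  ... | tri≈ _ a _ | tri< lt _ _ = ⊥-elim (edge-noncrossing (e₁₃ t) (e₂₃ u)
          (subst (λ z → toℕ (v₁ t) < toℕ z) e (v₁<v₂ t)) (subst (λ z → toℕ z < toℕ (v₃ t)) e (v₂<v₃ t)) lt)
  ... | tri≈ _ a _ | tri> _ _ gt = ⊥-elim (edge-noncrossing (e₁₃ u) (e₂₃ t)
          (subst (λ z → toℕ (v₁ u) < toℕ z) (sym e) (v₁<v₂ u)) (subst (λ z → toℕ z < toℕ (v₃ u)) (sym e) (v₂<v₃ u)) gt)
  ... | tri≈ _ a _ | tri≈ _ b _ = triangle-≡ (toℕ-injective a) e (toℕ-injective b)

  -- The edge `p`-`s` separates `k` from all other vertices, so a further edge at `k` would cross
  -- it. The cases of `go` are the positions of the wrap-around.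
  tip-neighbour : ∀ {p k s x} → k ≡ succ p → s ≡ succ k → p ≢ s → E p s → E k x → k ≢ x → x ≡ p ⊎ x ≡ s
  tip-neighbour {p} {k} {s} {x} kp sk ne ps kx k≢x with x Fin.≟ p | x Fin.≟ s
  ... | yes e | _ = inj₁ e
  ... | no _ | yes e = inj₂ e
  ... | no x≢p | no x≢s = ⊥-elim (go (succ⇒next kp) (succ⇒next sk))
    where
    go : Next n (toℕ p) (toℕ k) → Next n (toℕ k) (toℕ s) → ⊥
    go (inj₁ a) (inj₁ b) with <-cmp (toℕ x) (toℕ k)
    ... | tri< lt _ _ = edge-noncrossing (edge-sym kx) ps
            (≤∧≢⇒< (≤-pred (subst (toℕ x <_) a lt)) (x≢p ∘ toℕ-injective))
            (subst (toℕ p <_) (sym a) (n<1+n _)) (subst (toℕ k <_) (sym b) (n<1+n _))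
    ... | tri≈ _ e _ = k≢x (toℕ-injective (sym e))
    ... | tri> _ _ gt = edge-noncrossing ps kx (subst (toℕ p <_) (sym a) (n<1+n _))
            (subst (toℕ k <_) (sym b) (n<1+n _)) (≤∧≢⇒< (subst (_≤ toℕ x) (sym b) gt) (x≢s ∘ toℕ-injective ∘ sym))
    go (inj₁ a) (inj₂ (k≡n , s≡0)) = edge-noncrossing (edge-sym ps) (edge-sym kx)
      (≤∧≢⇒< (subst (_≤ toℕ x) (sym s≡0) z≤n) (x≢s ∘ toℕ-injective ∘ sym))
      (≤∧≢⇒< (≤-pred (subst (toℕ x <_) a x<k)) (x≢p ∘ toℕ-injective)) (subst (toℕ p <_) (sym a) (n<1+n _))
      where x<k = ≤∧≢⇒< (subst (toℕ x ≤_) (sym k≡n) (toℕ≤ x)) (k≢x ∘ toℕ-injective ∘ sym)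
    go (inj₂ (p≡n , k≡0)) (inj₁ b) = edge-noncrossing kx (edge-sym ps)
      (subst (toℕ k <_) (sym b) (n<1+n _)) (≤∧≢⇒< (subst (_≤ toℕ x) (sym b) k<x) (x≢s ∘ toℕ-injective ∘ sym))
      (≤∧≢⇒< (subst (toℕ x ≤_) (sym p≡n) (toℕ≤ x)) (x≢p ∘ toℕ-injective))
      where k<x = ≤∧≢⇒< (subst (_≤ toℕ x) (sym k≡0) z≤n) (k≢x ∘ toℕ-injective)
    go (inj₂ (p≡n , k≡0)) (inj₂ (k≡n , s≡0)) = ne (toℕ-injective (trans p≡n (trans (sym k≡n) (trans k≡0 (sym s≡0)))))

  tip-triangle : ∀ {p k s} → k ≡ succ p → s ≡ succ k → p ≢ s → ∀ t u →
                 p ∈ corners t → k ∈ corners t → s ∈ corners t → k ∈ corners u → u ≡ t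
  tip-triangle {p} {k} {s} kp sk ne t u p∈ k∈ s∈ k∈u = corners-⊆⇒≡ sub
    where
    sub : corners u ⊆ corners t
    sub {x} x∈ with k Fin.≟ x
    ... | yes refl = k∈
    ... | no k≢x with tip-neighbour kp sk ne (corner-edge t p∈ s∈ ne) (corner-edge u k∈u x∈ k≢x) k≢x
    ... | inj₁ refl = p∈
    ... | inj₂ refl = s∈

-- Deletion of vertices

-- Cyclic adjacency once the vertices in the list have been deleted one after
-- the other, the most recently deleted vertex standing first.
data Adj {m} : List (Fin m) → Fin m → Fin m → Set where
  side : ∀ {R u v} → u ∉ R → v ∉ R → Side u v → Adj R u v
  join : ∀ {R p k s} → Adj R p k → Adj R k s → p ≢ s → Adj (k ∷ R) p s

-- The label-free part of `IsRemoval`, strengthened so that it can be iterated: `adj⇒side`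
-- recognises the next tip, and `triangles-↭` lets sums over labels be split.
record Reduction {m} (T : Triangulation m) (R : List (Fin m)) (X : List (TriangleOf T)) (m′ : ℕ) : Set₁ where
  field
    T′            : Triangulation m′
    ι             : Fin m′ → Fin m
    ι-increasing  : ∀ {i j} → i Fin.< j → ι i Fin.< ι j
    ι∉            : ∀ i → ι i ∉ R
    ι-onto        : ∀ {v} → v ∉ R → ∃[ i ] ι i ≡ v
    embed         : TriangleOf T′ → TriangleOf T
    embed-corners : ∀ t′ → corners (embed t′) ≡ map ι (corners t′)
    embed∉        : ∀ t′ → embed t′ ∉ X
    embed-onto    : ∀ {t} → t ∉ X → ∃[ t′ ] embed t′ ≡ t
    triangles-↭   : triangles T ↭ X ++ map embed (triangles T′)
    adj⇒side      : ∀ {i j} → Adj R (ι i) (ι j) → Side i j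

  ι-injective : ∀ {i j} → ι i ≡ ι j → i ≡ j
  ι-injective {i} {j} e with <-cmp (toℕ i) (toℕ j)
  ... | tri< lt _ _ = contradiction (cong toℕ e) (<⇒≢ (ι-increasing lt))
  ... | tri≈ _ e′ _ = toℕ-injective e′
  ... | tri> _ _ gt = contradiction (cong toℕ (sym e)) (<⇒≢ (ι-increasing gt))

  embed-injective : ∀ {t u} → embed t ≡ embed u → t ≡ u
  embed-injective {t} {u} e
    with eqs ← trans (sym (embed-corners t)) (trans (cong corners e) (embed-corners u))
    = triangle-≡ (ι-injective (∷-injectiveˡ eqs)) (ι-injective (∷-injectiveˡ (∷-injectiveʳ eqs)))
                 (ι-injective (∷-injectiveˡ (∷-injectiveʳ (∷-injectiveʳ eqs))))

  corner⁻ : ∀ {t′ v} → v ∈ corners (embed t′) → ∃[ i ] (i ∈ corners t′ × v ≡ ι i)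
  corner⁻ {t′} {v} v∈ = ∈-map⁻ ι (subst (v ∈_) (embed-corners t′) v∈)

  corner-∉ : ∀ {t v} → t ∉ X → v ∈ corners t → v ∉ R
  corner-∉ t∉ v∈ with embed-onto t∉
  ... | t′ , refl with corner⁻ v∈
  ... | i , _ , refl = ι∉ i

all-image : ∀ {A B : Set} (f : A → B) {ys} → All (λ y → ∃[ x ] f x ≡ y) ys → ∃[ xs ] map f xs ≡ ys
all-image f [] = [] , refl
all-image f ((x , refl) ∷ ps) with all-image f ps
... | xs , refl = x ∷ xs , refl

module DeleteTip {n} (T : Triangulation (suc (suc n))) (t : TriangleOf T) {p k s : Fin (suc (suc n))}
  (k≡ : k ≡ succ p) (s≡ : s ≡ succ k) (p≢s : p ≢ s)
  (p∈ : p ∈ corners t) (k∈ : k ∈ corners t) (s∈ : s ∈ corners t) where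

  open Triangulation T using (proper; unique; complete; count)
  open Geometry T

  ι : Fin (suc n) → Fin (suc (suc n))
  ι = punchIn k

  -- The edge `p`-`s` turns into a side and must not remain a diagonal. Starting from all edges `E`
  -- makes `edge⁻` a mere case split on `Side`.
  Diagonal′ : Rel (Fin (suc n)) 0ℓ
  Diagonal′ i j = E (ι i) (ι j) × ¬ Side i j

  succ-edge : ∀ {i j} → j ≡ succ i → E (ι i) (ι j)
  succ-edge e with succ-punchIn⁺ k e
  ... | inj₁ a = inj₁ (inj₁ a)
  ... | inj₂ (a , b) = subst₂ E (succ-injective (trans (sym k≡) a)) (trans s≡ (sym b)) (corner-edge t p∈ s∈ p≢s)

  edge⁺ : ∀ {i j} → Edge Diagonal′ i j → E (ι i) (ι j)
  edge⁺ (inj₁ (inj₁ e)) = succ-edge e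
  edge⁺ (inj₁ (inj₂ e)) = edge-sym (succ-edge e)
  edge⁺ (inj₂ (e , _)) = e

  edge⁻ : ∀ {i j} → E (ι i) (ι j) → Edge Diagonal′ i j
  edge⁻ {i} {j} e with side? i j
  ... | yes s = inj₁ s
  ... | no ¬s = inj₂ (e , ¬s)

  proper′ : ∀ {i j} → Diagonal′ i j → i ≢ j × ¬ Side i j
  proper′ (inj₁ s , ¬s) = contradiction (side-punchIn⁻ k s) ¬s
  proper′ (inj₂ d , ¬s) = (λ { refl → proj₁ (proper d) refl }) , ¬s

  embed : Triangle Diagonal′ → TriangleOf T
  embed (triangle a b c a<b b<c ab bc ac) =
    triangle (ι a) (ι b) (ι c) (punchIn-mono-< k a<b) (punchIn-mono-< k b<c) (edge⁺ ab) (edge⁺ bc) (edge⁺ ac)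

  embed-corners : ∀ t′ → corners (embed t′) ≡ map ι (corners t′)
  embed-corners (triangle _ _ _ _ _ _ _ _) = refl

  k∉embed : ∀ t′ → k ∉ corners (embed t′)
  k∉embed t′ k∈′ with ∈-map⁻ ι (subst (k ∈_) (embed-corners t′) k∈′)
  ... | i , _ , e = punchInᵢ≢i k i (sym e)

  embed≢t : ∀ t′ → embed t′ ≢ t
  embed≢t t′ refl = k∉embed t′ k∈

  embed-triangle : ∀ a b c u → ι a ≡ v₁ u → ι b ≡ v₂ u → ι c ≡ v₃ u → ∃[ t′ ] embed t′ ≡ u
  embed-triangle a b c (triangle _ _ _ a<b b<c ab bc ac) refl refl refl =
    triangle a b c (punchIn-cancel-< k a<b) (punchIn-cancel-< k b<c) (edge⁻ ab) (edge⁻ bc) (edge⁻ ac) , refl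

  embed-onto : ∀ {u} → u ≢ t → ∃[ t′ ] embed t′ ≡ u
  embed-onto {u} u≢t =
    embed-triangle _ _ _ u (punchIn-punchOut (k≢ (here refl))) (punchIn-punchOut (k≢ (there (here refl))))
                           (punchIn-punchOut (k≢ (there (there (here refl)))))
    where
    k≢ : ∀ {v} → v ∈ corners u → k ≢ v
    k≢ v∈ refl = u≢t (tip-triangle k≡ s≡ p≢s t u p∈ k∈ s∈ v∈)

  embed-injective : ∀ {t′ u′} → embed t′ ≡ embed u′ → t′ ≡ u′
  embed-injective {triangle _ _ _ _ _ _ _ _} {triangle _ _ _ _ _ _ _ _} e =
    triangle-≡ (punchIn-injective k _ _ (cong v₁ e)) (punchIn-injective k _ _ (cong v₂ e))
               (punchIn-injective k _ _ (cong v₃ e))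

  rest : List (TriangleOf T)
  rest = proj₁ (∈⇒↭ (complete t))

  rest-↭ : triangles T ↭ t ∷ rest
  rest-↭ = proj₂ (∈⇒↭ (complete t))

  unique-rest : Unique (t ∷ rest)
  unique-rest = PermS.Unique-resp-↭ (setoid _) (↭⇒↭ₛ rest-↭) unique

  preimages : ∃[ ts ] map embed ts ≡ rest
  preimages = all-image embed (All.map (λ t≢ → embed-onto (t≢ ∘ sym)) (AllPairs.head unique-rest))

  triangles′ : List (Triangle Diagonal′)
  triangles′ = proj₁ preimages

  embed-triangles′ : map embed triangles′ ≡ rest
  embed-triangles′ = proj₂ preimages

  complete′ : ∀ t′ → t′ ∈ triangles′
  complete′ t′ with ∈-resp-↭ rest-↭ (complete (embed t′))
  ... | here e = contradiction e (embed≢t t′)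
  ... | there q with ∈-map⁻ embed (subst (embed t′ ∈_) (sym embed-triangles′) q)
  ... | u′ , u′∈ , e = subst (_∈ triangles′) (sym (embed-injective e)) u′∈

  unique′ : Unique triangles′
  unique′ = Unique.map⁻ (subst Unique (sym embed-triangles′) (AllPairs.tail unique-rest))

  -- The triangle `t` itself bounds `n` away from 0, which keeps two vertices in the smaller polygon
  -- and makes the truncated subtraction in `count` exact.
  n≡ : n ≡ suc (length triangles′)
  n≡ = trans (sym count) (trans (↭-length rest-↭)
         (cong suc (trans (cong length (sym embed-triangles′)) (length-map embed triangles′))))

  T′ : Triangulation (suc n)
  T′ = record
    { m≥2 = subst (λ z → 2 ≤ suc z) (sym n≡) (s≤s (s≤s z≤n))
    ; Diagonal = Diagonal′
    ; diagonal? = λ i j → edge? (ι i) (ι j) ×-dec ¬? (side? i j)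
    ; symmetric = λ (e , ¬s) → edge-sym e , ¬s ∘ swap
    ; proper = proper′
    ; noncrossing = λ (e , _) (f , _) (a , b , c) →
        edge-noncrossing e f (punchIn-mono-< k a) (punchIn-mono-< k b) (punchIn-mono-< k c)
    ; triangles = triangles′
    ; unique = unique′
    ; complete = complete′
    ; count = sym (cong (_∸ 1) n≡)
    }

  adj : ∀ {i j} → Adj (k ∷ []) (ι i) (ι j) → Side i j
  adj (side _ _ s) = side-punchIn⁻ k s
  adj (join (side _ _ a) (side _ _ b) ne) = side-skip k a b ne

  reduction : Reduction T (k ∷ []) (t ∷ []) (suc n)
  reduction = record
    { T′ = T′
    ; ι = ι
    ; ι-increasing = punchIn-mono-< k
    ; ι∉ = λ { i (here e) → punchInᵢ≢i k i e }
    ; ι-onto = λ v∉ → _ , punchIn-punchOut {i = k} (λ e → v∉ (here (sym e)))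
    ; embed = embed
    ; embed-corners = embed-corners
    ; embed∉ = λ { t′ (here e) → embed≢t t′ e }
    ; embed-onto = λ u∉ → embed-onto (u∉ ∘ here)
    ; triangles-↭ = subst (λ r → triangles T ↭ t ∷ r) (sym embed-triangles′) rest-↭
    ; adj⇒side = adj
    }

delete-tip : ∀ {m} (T : Triangulation m) (t : TriangleOf T) {p k s : Fin m} → Side p k → Side k s → p ≢ s →
             p ∈ corners t → k ∈ corners t → s ∈ corners t → Reduction T (k ∷ []) (t ∷ []) (m ∸ 1)
delete-tip {suc zero} T _ {Fin.zero} {_} {Fin.zero} _ _ p≢s _ _ _ = contradiction refl p≢s
delete-tip {suc (suc n)} T t a b p≢s p∈ k∈ s∈ with neighbours a b p≢s
... | inj₁ (k≡ , s≡) = DeleteTip.reduction T t k≡ s≡ p≢s p∈ k∈ s∈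
... | inj₂ (k≡ , p≡) = DeleteTip.reduction T t k≡ p≡ (p≢s ∘ sym) s∈ k∈ p∈

no-reduction : ∀ {m} {T : Triangulation m} → Reduction T [] [] m
no-reduction {T = T} = record
  { T′ = T
  ; ι = id
  ; ι-increasing = id
  ; ι∉ = λ _ ()
  ; ι-onto = λ _ → _ , refl
  ; embed = id
  ; embed-corners = λ _ → refl
  ; embed∉ = λ _ ()
  ; embed-onto = λ _ → _ , refl
  ; triangles-↭ = ↭-reflexive (sym (map-id (triangles T)))
  ; adj⇒side = λ { (side _ _ s) → s }
  }

module _ {m} {T : Triangulation m} {R X m₁} (r : Reduction T R X m₁) where
  private module r = Reduction r

  -- One deletion is appended at a time, just as `join` peels one vertex off the list; this is what
  -- makes `adj` go through.
  compose : ∀ {k t m₂} → Reduction r.T′ (k ∷ []) (t ∷ []) m₂ → Reduction T (r.ι k ∷ R) (r.embed t ∷ X) m₂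
  compose {k} {t} q = record
    { T′ = q.T′
    ; ι = r.ι ∘ q.ι
    ; ι-increasing = r.ι-increasing ∘ q.ι-increasing
    ; ι∉ = λ { i (here e) → q.ι∉ i (here (r.ι-injective e)) ; i (there v∈) → r.ι∉ _ v∈ }
    ; ι-onto = onto
    ; embed = r.embed ∘ q.embed
    ; embed-corners = λ t′ → trans (r.embed-corners _)
        (trans (cong (map r.ι) (q.embed-corners t′)) (sym (map-∘ {g = r.ι} {f = q.ι} (corners t′))))
    ; embed∉ = λ { i (here e) → q.embed∉ i (here (r.embed-injective e)) ; i (there v∈) → r.embed∉ _ v∈ }
    ; embed-onto = embed-onto
    ; triangles-↭ = ↭-trans r.triangles-↭ (↭-trans
        (++⁺ˡ X (↭-trans (Perm.map⁺ r.embed q.triangles-↭) (prep _ (↭-reflexive (sym (map-∘ (triangles q.T′)))))))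
        (shift _ X _))
    ; adj⇒side = adj
    }
    where
    module q = Reduction q
    onto : ∀ {v} → v ∉ r.ι k ∷ R → ∃[ i ] r.ι (q.ι i) ≡ v
    onto v∉ with r.ι-onto (v∉ ∘ there)
    ... | i , refl with q.ι-onto {i} (λ { (here refl) → v∉ (here refl) })
    ... | j , refl = j , refl
    embed-onto : ∀ {v} → v ∉ r.embed t ∷ X → ∃[ i ] r.embed (q.embed i) ≡ v
    embed-onto v∉ with r.embed-onto (v∉ ∘ there)
    ... | i , refl with q.embed-onto {i} (λ { (here refl) → v∉ (here refl) })
    ... | j , refl = j , refl
    adj : ∀ {i j} → Adj (r.ι k ∷ R) (r.ι (q.ι i)) (r.ι (q.ι j)) → Side i j
    adj (side a b s) = q.adj⇒side (side (q.ι∉ _) (q.ι∉ _) (r.adj⇒side (side (a ∘ there) (b ∘ there) s)))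
    adj (join a b ne) = q.adj⇒side
      (join (side (λ ()) (λ ()) (r.adj⇒side a)) (side (λ ()) (λ ()) (r.adj⇒side b)) (ne ∘ cong r.ι))

  -- All data are given in the original polygon, so that callers never touch the renumbered
  -- vertices.
  extend : ∀ {t p k s} → t ∉ X → p ∈ corners t → k ∈ corners t → s ∈ corners t →
           Adj R p k → Adj R k s → p ≢ s → Reduction T (k ∷ R) (t ∷ X) (m₁ ∸ 1)
  extend t∉ p∈ k∈ s∈ a b p≢s with r.embed-onto t∉
  ... | t′ , refl with r.corner⁻ p∈ | r.corner⁻ k∈ | r.corner⁻ s∈
  ... | p′ , p′∈ , refl | k′ , k′∈ , refl | s′ , s′∈ , refl =
    compose (delete-tip r.T′ t′ (r.adj⇒side a) (r.adj⇒side b) (p≢s ∘ cong r.ι) p′∈ k′∈ s′∈)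

-- Labels and the parity of d

-- Twice the contribution of a label to d.
weight : ℤ → ℕ
weight (+ zero)  = 1
weight (+ suc _) = 0
weight -[1+ _ ]  = 2

weight-neg : ∀ c → weight (- c) + weight c ≡ 2
weight-neg (+ zero)  = refl
weight-neg (+ suc _) = refl
weight-neg -[1+ _ ]  = refl

module _ {A : Set} where

  total : (A → ℤ) → List A → ℕ
  total f xs = sum (map (weight ∘ f) xs)

  total-++ : ∀ f xs ys → total f (xs ++ ys) ≡ total f xs + total f ys
  total-++ f xs ys = trans (cong sum (map-++ (weight ∘ f) xs ys)) (sum-++ (map (weight ∘ f) xs) _)

  total-↭ : ∀ f {xs ys} → xs ↭ ys → total f xs ≡ total f ys
  total-↭ f p = sum-↭ (Perm.map⁺ (weight ∘ f) p)

  total-neg : ∀ f xs → total (-_ ∘ f) xs + total f xs ≡ 2 * length xs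
  total-neg f [] = refl
  total-neg f (x ∷ xs) = trans (rearrange (weight (- f x)) (total (-_ ∘ f) xs) (weight (f x)) (total f xs))
    (trans (cong₂ _+_ (weight-neg (f x)) (total-neg f xs)) (double (length xs)))
    where
    rearrange : ∀ p q r s → (p + q) + (r + s) ≡ (p + r) + (q + s)
    rearrange = solve-∀
    double : ∀ l → 2 + 2 * l ≡ 2 * (1 + l)
    double = solve-∀

  total-count : ∀ f xs → length (filter (λ x → f x ℤ.<? 0ℤ) xs) * 2 + length (filter (λ x → f x ℤ.≟ 0ℤ) xs)
                         ≡ total f xs
  total-count f [] = refl
  total-count f (x ∷ xs) with f x
  ... | + zero  = trans (+-suc _ _) (cong suc (total-count f xs))
  ... | + suc _ = total-count f xs
  ... | -[1+ _ ] = cong (suc ∘ suc) (total-count f xs)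

total-map : ∀ {A B : Set} f (g : A → B) xs → total f (map g xs) ≡ total (f ∘ g) xs
total-map f g xs = cong sum (sym (map-∘ xs))

module _ {m} (T : Triangulation m) (a : Labelling T) where

  private
    N = negatives T a
    Z = zeros T a

    -- The left side is the literal cross product of the unnormalised sum: `N` doubled plus `Z`,
    -- times the denominator 1 of an integer. So `total` is `2d`.
    numerator : (+ N ℤ.* + 2 ℤ.+ + Z ℤ.* + 1) ℤ.* + 1 ≡ + total a (triangles T)
    numerator = trans (ℤₚ.*-identityʳ _) (trans (cong₂ ℤ._+_ (sym (pos-* N 2)) (ℤₚ.*-identityʳ (+ Z)))
                  (trans (sym (pos-+ (N * 2) Z)) (cong +_ (total-count a (triangles T)))))

  even⇒4∣total : ∀ {e} → d T a ≃ (+ 2 ℤ.* e) /ᵘ 1 → 4 ∣ total a (triangles T)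
  even⇒4∣total {e} (*≡* p) = divides ℤ.∣ e ∣ (trans (cong ℤ.∣_∣ (trans (sym numerator) p))
    (trans (abs-* (+ 2 ℤ.* e) (+ 2)) (trans (cong (_* 2) (abs-* (+ 2) e)) (rearrange ℤ.∣ e ∣))))
    where
    rearrange : ∀ l → 2 * l * 2 ≡ l * 4
    rearrange = solve-∀

  4∣total⇒even : 4 ∣ total a (triangles T) → ∃[ e ] d T a ≃ (+ 2 ℤ.* e) /ᵘ 1
  4∣total⇒even (divides q p) = + q , *≡* (trans numerator (trans (cong +_ (trans p (rearrange q)))
    (trans (pos-* (2 * q) 2) (cong (ℤ._* + 2) (pos-* 2 q)))))
    where
    rearrange : ∀ l → l * 4 ≡ 2 * l * 2
    rearrange = solve-∀

Unit : ℤ → Set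
Unit c = c ≡ 1ℤ ⊎ c ≡ -1ℤ

-- What a relabelling has to respect for the squares to stay the same.
record Symmetry (f : ℤ → ℤ) : Set where
  field
    unit⁺ : ∀ {c} → Unit c → Unit (f c)
    unit⁻ : ∀ {c} → Unit (f c) → Unit c
    odd   : ∀ c → f (- c) ≡ - f c

id-symmetry : Symmetry id
id-symmetry = record { unit⁺ = id ; unit⁻ = id ; odd = λ _ → refl }

neg-symmetry : Symmetry -_
neg-symmetry = record { unit⁺ = neg-unit ; unit⁻ = λ {c} u → subst Unit (neg-involutive c) (neg-unit u) ; odd = λ _ → refl }
  where
  neg-unit : ∀ {c} → Unit c → Unit (- c)
  neg-unit (inj₁ refl) = inj₂ refl
  neg-unit (inj₂ refl) = inj₁ refl

module _ {m} {T : Triangulation m} {a : Labelling T} (A : Admissible T a) where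
  private module A = Admissible A

  unsquared : ∀ {t u} → A.Square t u → ¬ Unit (a t)
  unsquared sq (inj₁ e) = proj₁ (A.nonunit sq) e
  unsquared sq (inj₂ e) = proj₂ (A.nonunit sq) e

  partner-unique : ∀ {t u v} → A.Square t u → A.Square t v → u ≡ v
  partner-unique {t} sq sq′ with A.partition t (proj₁ (A.nonunit sq)) (proj₂ (A.nonunit sq))
  ... | _ , _ , uniq = trans (sym (uniq sq)) (uniq sq′)

  total-square : ∀ {t u} → A.Square t u → ∀ X → total a (t ∷ u ∷ X) ≡ 2 + total a X
  total-square {t} {u} sq X rewrite A.opposite sq =
    trans (sym (+-assoc (weight (- a u)) (weight (a u)) (total a X))) (cong (_+ total a X) (weight-neg (a u)))

  -- A union of whole squares and single unit triangles: removing it breaks no square.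
  Closed : List (TriangleOf T) → Set
  Closed X = ∀ {t u} → A.Square t u → t ∈ X → u ∈ X

  unit-closed : ∀ {X} → All (Unit ∘ a) X → Closed X
  unit-closed us sq t∈ = contradiction (All.lookup us t∈) (unsquared sq)

  square-closed : ∀ {t u X} → A.Square t u → Closed X → Closed (t ∷ u ∷ X)
  square-closed sq cl sq′ (here refl) = there (here (partner-unique sq′ sq))
  square-closed sq cl sq′ (there (here refl)) = here (partner-unique sq′ (A.symmetric sq))
  square-closed sq cl sq′ (there (there t∈)) = there (there (cl sq′ t∈))

  module _ {R X m′} (r : Reduction T R X m′) where
    private module r = Reduction r

    remaining-admissible : ∀ {f} → Closed X → Symmetry f → 4 ∣ total (f ∘ a ∘ r.embed) (triangles r.T′) →
                           Admissible r.T′ (f ∘ a ∘ r.embed)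
    remaining-admissible {f} closed S 4∣ = record
      { Square = λ t u → A.Square (r.embed t) (r.embed u)
      ; symmetric = A.symmetric
      ; distinct = λ sq → A.distinct sq ∘ cong r.embed
      ; nonunit = λ sq → (λ e → unsquared sq (S.unit⁻ (inj₁ e))) , (λ e → unsquared sq (S.unit⁻ (inj₂ e)))
      ; partition = partner
      ; adjacent = adjacent
      ; opposite = λ {t} {u} sq → trans (cong f (A.opposite sq)) (S.odd (a (r.embed u)))
      ; d-even = 4∣total⇒even r.T′ (f ∘ a ∘ r.embed) 4∣
      }
      where
      module S = Symmetry S
      partner : ∀ t → f (a (r.embed t)) ≢ 1ℤ → f (a (r.embed t)) ≢ -1ℤ →
                ∃[ u ] (A.Square (r.embed t) (r.embed u) × (∀ {v} → A.Square (r.embed t) (r.embed v) → u ≡ v))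
      partner t ≢1 ≢-1 with A.partition (r.embed t) (nonunit ∘ inj₁) (nonunit ∘ inj₂)
        where
        nonunit : ¬ Unit (a (r.embed t))
        nonunit u = [ ≢1 , ≢-1 ]′ (S.unit⁺ u)
      -- The partner survives: were it removed, closedness would have removed `t` as well.
      ... | u , sq , uniq with r.embed-onto {u} (λ u∈ → r.embed∉ t (closed (A.symmetric sq) u∈))
      ... | u′ , refl = u′ , sq , r.embed-injective ∘ uniq
      adjacent : ∀ {t u} → A.Square (r.embed t) (r.embed u) →
                 ∃[ x ] ∃[ y ] (x ≢ y × x ∈ corners t × y ∈ corners t × x ∈ corners u × y ∈ corners u)
      adjacent sq with A.adjacent sq
      ... | x , y , x≢y , xt , yt , xu , yu with r.corner⁻ xt | r.corner⁻ yt | r.corner⁻ xu | r.corner⁻ yu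
      ... | x′ , xt′ , refl | y′ , yt′ , refl | x″ , xu′ , ex | y″ , yu′ , ey
        with refl ← r.ι-injective ex | refl ← r.ι-injective ey
        = x′ , y′ , x≢y ∘ cong r.ι , xt′ , yt′ , xu′ , yu′

    -- Deletions list vertices and triangles with the latest first; `R₀` and `X₀` allow the order in
    -- which the theorem names them.
    removal : ∀ {R₀ X₀ f} → Closed X → Symmetry f → R ⊆ R₀ → R₀ ⊆ R → X ⊆ X₀ → X₀ ⊆ X →
              4 ∣ total (f ∘ a ∘ r.embed) (triangles r.T′) → RemovalAdmissible T a R₀ X₀ f m′
    removal {f = f} closed S R⊆ R⊇ X⊆ X⊇ 4∣ = r.T′ , f ∘ a ∘ r.embed , record
      { ι = r.ι
      ; ι-increasing = r.ι-increasing
      ; ι-image = λ v → mk⇔ (λ { (i , refl) → r.ι∉ i ∘ R⊇ }) (λ v∉ → r.ι-onto (v∉ ∘ R⊆))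
      ; embed = r.embed
      ; embed-corners = r.embed-corners
      ; embed-image = λ t → mk⇔ (λ { (t′ , refl) → r.embed∉ t′ ∘ X⊇ }) (λ t∉ → r.embed-onto (t∉ ∘ X⊆))
      ; labels = λ _ → refl
      } , remaining-admissible closed S 4∣

    total-remaining : total a (triangles T) ≡ total a X + total (a ∘ r.embed) (triangles r.T′)
    total-remaining = trans (total-↭ a r.triangles-↭) (trans (total-++ a X _)
                        (cong (λ z → total a X + z) (total-map a r.embed (triangles r.T′))))

    4∣total : 4 ∣ total a (triangles T)
    4∣total = even⇒4∣total T a (proj₂ A.d-even)

    4∣remaining : 4 ∣ total a X → 4 ∣ total (a ∘ r.embed) (triangles r.T′)
    4∣remaining = ∣m+n∣m⇒∣n (subst (4 ∣_) total-remaining 4∣total)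

    -- The remaining labels and their negatives together weigh 2 per remaining triangle. Adding the
    -- weight of `X` turns the remaining labels into the full total, which 4 divides.
    4∣negated : 4 ∣ 2 * (m′ ∸ 2) + total a X → 4 ∣ total (-_ ∘ a ∘ r.embed) (triangles r.T′)
    4∣negated 4∣ = ∣m+n∣m⇒∣n (subst (4 ∣_) eq 4∣) 4∣total
      where
      ts = triangles r.T′
      rearrange : ∀ p q r → p + q + r ≡ r + q + p
      rearrange = solve-∀
      eq : 2 * (m′ ∸ 2) + total a X ≡ total a (triangles T) + total (-_ ∘ a ∘ r.embed) ts
      eq = trans (cong (_+ total a X) (trans (cong (2 *_) (sym (Triangulation.count r.T′)))
                                         (sym (total-neg (a ∘ r.embed) ts))))
             (trans (rearrange (total (-_ ∘ a ∘ r.embed) ts) (total (a ∘ r.embed) ts) (total a X))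
               (cong (_+ total (-_ ∘ a ∘ r.embed) ts) (sym total-remaining)))

-- Ears and squares on the boundary

⊆⊇⇒∼ : ∀ {A : Set} {xs ys : List A} → xs ⊆ ys → ys ⊆ xs → xs ∼[ set ] ys
⊆⊇⇒∼ p q = mk⇔ p q

module Pieces {m} (T : Triangulation m) where

  record Ear (t : TriangleOf T) : Set where
    field
      {α β γ} : Fin m
      β≡      : β ≡ succ α
      γ≡      : γ ≡ succ β
      chain!  : Unique (α ∷ β ∷ γ ∷ [])
      chain⊆  : All (_∈ corners t) (α ∷ β ∷ γ ∷ [])

  -- The two ways of cutting the quadrilateral α β γ δ; t is a triangle with
  -- two sides on the polygon if α β γ δ are consecutive, and so is u once the
  -- middle vertex of t is gone.
  data Split (α β γ δ : Fin m) (t u : TriangleOf T) : Set where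
    diag-αγ : All (_∈ corners t) (α ∷ β ∷ γ ∷ []) → All (_∈ corners u) (α ∷ γ ∷ δ ∷ []) → Split α β γ δ t u
    diag-βδ : All (_∈ corners t) (β ∷ γ ∷ δ ∷ []) → All (_∈ corners u) (α ∷ β ∷ δ ∷ []) → Split α β γ δ t u

  record SquareLeaf (t u : TriangleOf T) : Set where
    field
      {α β γ δ} : Fin m
      β≡        : β ≡ succ α
      γ≡        : γ ≡ succ β
      δ≡        : δ ≡ succ γ
      chain!    : Unique (α ∷ β ∷ γ ∷ δ ∷ [])
      split     : Split α β γ δ t u

  corners⊆ : ∀ {α β γ} {t : TriangleOf T} → Unique (α ∷ β ∷ γ ∷ []) → All (_∈ corners t) (α ∷ β ∷ γ ∷ []) →
             corners t ⊆ α ∷ β ∷ γ ∷ []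
  corners⊆ chain! chain⊆ = unique∧⊆⇒⊇ chain! (All.lookup chain⊆) ≤-refl

  ear-corners : ∀ {t} (e : Ear t) → let open Ear e in corners t ∼[ set ] (pred β ∷ β ∷ succ β ∷ [])
  ear-corners {t} record { α = α ; β≡ = refl ; γ≡ = refl ; chain! = chain! ; chain⊆ = chain⊆ } =
    subst (λ z → corners t ∼[ set ] (z ∷ succ α ∷ succ (succ α) ∷ [])) (sym (pred-succ α))
      (⊆⊇⇒∼ (corners⊆ {t = t} chain! chain⊆) (All.lookup chain⊆))

  square-corners : ∀ {t u} (q : SquareLeaf t u) → let open SquareLeaf q in
                   (corners t ++ corners u) ∼[ set ] (pred β ∷ β ∷ succ β ∷ succ (succ β) ∷ [])
  square-corners {t} {u} record { α = α ; β≡ = refl ; γ≡ = refl ; δ≡ = refl ; chain! = chain! ; split = s } =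
    subst (λ z → (corners t ++ corners u) ∼[ set ] (z ∷ β ∷ γ ∷ δ ∷ [])) (sym (pred-succ α))
      (⊆⊇⇒∼ (λ v∈ → [ sub₁ chain! s , sub₂ chain! s ]′ (∈-++⁻ (corners t) v∈)) (sup s))
    where
    β = succ α
    γ = succ β
    δ = succ γ
    sub₁ : Unique (α ∷ β ∷ γ ∷ δ ∷ []) → Split α β γ δ t u → corners t ⊆ α ∷ β ∷ γ ∷ δ ∷ []
    sub₁ ((p ∷ q ∷ _ ∷ []) ∷ (r ∷ _ ∷ []) ∷ _) (diag-αγ x _) v∈
      with corners⊆ {t = t} ((p ∷ q ∷ []) ∷ (r ∷ []) ∷ [] ∷ []) x v∈
    ... | here e = here e
    ... | there (here e) = there (here e)
    ... | there (there (here e)) = there (there (here e))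
    sub₁ (_ ∷ rest!) (diag-βδ x _) v∈ = there (corners⊆ {t = t} rest! x v∈)
    sub₂ : Unique (α ∷ β ∷ γ ∷ δ ∷ []) → Split α β γ δ t u → corners u ⊆ α ∷ β ∷ γ ∷ δ ∷ []
    sub₂ ((_ ∷ q ∷ r ∷ []) ∷ _ ∷ (w ∷ []) ∷ _) (diag-αγ _ x) v∈
      with corners⊆ {t = u} ((q ∷ r ∷ []) ∷ (w ∷ []) ∷ [] ∷ []) x v∈
    ... | here e = here e
    ... | there (here e) = there (there (here e))
    ... | there (there (here e)) = there (there (there (here e)))
    sub₂ ((p ∷ _ ∷ r ∷ []) ∷ (_ ∷ w ∷ []) ∷ _) (diag-βδ _ x) v∈
      with corners⊆ {t = u} ((p ∷ r ∷ []) ∷ (w ∷ []) ∷ [] ∷ []) x v∈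
    ... | here e = here e
    ... | there (here e) = there (here e)
    ... | there (there (here e)) = there (there (there (here e)))
    sup : Split α β γ δ t u → α ∷ β ∷ γ ∷ δ ∷ [] ⊆ corners t ++ corners u
    sup (diag-αγ (a ∷ b ∷ c ∷ []) (_ ∷ _ ∷ d ∷ [])) =
      All.lookup (∈-++⁺ˡ a ∷ ∈-++⁺ˡ b ∷ ∈-++⁺ˡ c ∷ ∈-++⁺ʳ (corners t) d ∷ [])
    sup (diag-βδ (b ∷ c ∷ d ∷ []) (a ∷ _ ∷ _ ∷ [])) =
      All.lookup (∈-++⁺ʳ (corners t) a ∷ ∈-++⁺ˡ b ∷ ∈-++⁺ˡ c ∷ ∈-++⁺ˡ d ∷ [])

  module _ {R X m′} (r : Reduction T R X m′) where
    open Reduction r using (corner-∉)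

    -- An ear outside `X` is still an ear after `X` is gone: its triangle survives, so none of its
    -- corners was deleted, and sides between surviving vertices remain sides.
    remove-ear : ∀ {t} (e : Ear t) → t ∉ X → Reduction T (Ear.β e ∷ R) (t ∷ X) (m′ ∸ 1)
    remove-ear {t} record { β≡ = β≡ ; γ≡ = γ≡ ; chain! = (_ ∷ αγ ∷ []) ∷ _ ; chain⊆ = a ∷ b ∷ c ∷ [] } t∉ =
      extend r t∉ a b c (side (corner-∉ t∉ a) (corner-∉ t∉ b) (inj₁ β≡))
                        (side (corner-∉ t∉ b) (corner-∉ t∉ c) (inj₁ γ≡)) αγ

    private
      ∉-∷ : ∀ {x y : Fin m} → x ≢ y → x ∉ R → x ∉ y ∷ R
      ∉-∷ x≢y x∉ (here e) = x≢y e
      ∉-∷ x≢y x∉ (there x∈) = x∉ x∈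

      swap⊆ : ∀ {x y : Fin m} → x ∷ y ∷ R ⊆ y ∷ x ∷ R
      swap⊆ (here e) = there (here e)
      swap⊆ (there (here e)) = here e
      swap⊆ (there (there v∈)) = there (there v∈)

    -- The middle vertex of `t` goes first, which is `β` or `γ` according to the diagonal; `join`
    -- then supplies the new side at the tip of `u`. The order of the two deletions depends on this,
    -- so the list is fixed only up to inclusions.
    remove-square : ∀ {t u} (q : SquareLeaf t u) → let open SquareLeaf q in t ≢ u → t ∉ X → u ∉ X →
                    ∃[ R′ ] (Reduction T R′ (u ∷ t ∷ X) (m′ ∸ 1 ∸ 1) × R′ ⊆ β ∷ succ β ∷ R × β ∷ succ β ∷ R ⊆ R′)
    remove-square record { β≡ = β≡ ; γ≡ = refl ; δ≡ = δ≡
                         ; chain! = (_ ∷ αγ≢ ∷ αδ≢ ∷ []) ∷ (βγ≢ ∷ βδ≢ ∷ []) ∷ _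
                         ; split = diag-αγ (a ∷ b ∷ c ∷ []) (a′ ∷ c′ ∷ d ∷ []) } t≢u t∉ u∉ =
      _ , extend (extend r t∉ a b c α-β β-γ αγ≢) (λ { (here e) → t≢u (sym e) ; (there u∈) → u∉ u∈ }) a′ c′ d
            (join α-β β-γ αγ≢)
            (side (∉-∷ (βγ≢ ∘ sym) (corner-∉ t∉ c)) (∉-∷ (βδ≢ ∘ sym) (corner-∉ u∉ d)) (inj₁ δ≡)) αδ≢ ,
      swap⊆ , swap⊆
      where
      α-β = side (corner-∉ t∉ a) (corner-∉ t∉ b) (inj₁ β≡)
      β-γ = side (corner-∉ t∉ b) (corner-∉ t∉ c) (inj₁ refl)
    remove-square record { β≡ = β≡ ; γ≡ = refl ; δ≡ = δ≡
                         ; chain! = (_ ∷ αγ≢ ∷ αδ≢ ∷ []) ∷ (βγ≢ ∷ βδ≢ ∷ []) ∷ _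
                         ; split = diag-βδ (b ∷ c ∷ d ∷ []) (a ∷ b′ ∷ d′ ∷ []) } t≢u t∉ u∉ =
      _ , extend (extend r t∉ b c d β-γ γ-δ βδ≢) (λ { (here e) → t≢u (sym e) ; (there u∈) → u∉ u∈ }) a b′ d′
            (side (∉-∷ αγ≢ (corner-∉ u∉ a)) (∉-∷ βγ≢ (corner-∉ t∉ b)) (inj₁ β≡))
            (join β-γ γ-δ βδ≢) αδ≢ ,
      id , id
      where
      β-γ = side (corner-∉ t∉ b) (corner-∉ t∉ c) (inj₁ refl)
      γ-δ = side (corner-∉ t∉ c) (corner-∉ t∉ d) (inj₁ δ≡)

  -- A common view of ears and squares for proving `Apart`: the tip is seen only by its own piece,
  -- while that piece also reaches the next vertex. Hence disjoint pieces cannot have equal or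
  -- consecutive tips.
  record Tip (X : List (TriangleOf T)) (k : Fin m) : Set where
    field
      covers      : ∃[ t ] (t ∈ X × k ∈ corners t)
      covers-succ : ∃[ t ] (t ∈ X × succ k ∈ corners t)
      avoided     : ∀ {t} → t ∉ X → k ∉ corners t

  tips-apart : ∀ {X Y j k} → Disjoint X Y → Tip X j → Tip Y k → Apart j k
  tips-apart {X} {Y} {j} {k} dis p q =
    (λ { refl → let t , t∈ , j∈ = p.covers in q.avoided (λ t∈Y → dis (t∈ , t∈Y)) j∈ }) ,
    (λ { refl → let t , t∈ , j∈ = q.covers-succ in p.avoided (λ t∈X → dis (t∈X , t∈)) j∈ }) ,
    (λ { refl → let t , t∈ , k∈ = p.covers-succ in q.avoided (λ t∈Y → dis (t∈ , t∈Y)) k∈ })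
    where
    module p = Tip p
    module q = Tip q

  ear-tip : ∀ {t} (e : Ear t) → Tip (t ∷ []) (Ear.β e)
  ear-tip {t} e@record { γ≡ = refl ; chain⊆ = _ ∷ b ∷ c ∷ [] } = record
    { covers = t , here refl , b
    ; covers-succ = t , here refl , c
    -- A triangle other than `t` survives the removal of the ear, and survivors have no deleted
    -- corner.
    ; avoided = λ t∉ k∈ → Reduction.corner-∉ (remove-ear no-reduction e λ ()) t∉ k∈ (here refl)
    }

  square-tip : ∀ {t u} (q : SquareLeaf t u) → t ≢ u → Tip (t ∷ u ∷ []) (SquareLeaf.β q)
  square-tip {t} {u} q@record { γ≡ = refl ; split = s } t≢u = record
    { covers = covers s
    ; covers-succ = covers-succ s
    ; avoided = λ t∉ k∈ → let _ , r , _ , ⊇ = remove-square no-reduction q t≢u (λ ()) (λ ()) in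
        Reduction.corner-∉ r (λ { (here e) → t∉ (there (here e)) ; (there (here e)) → t∉ (here e) }) k∈ (⊇ (here refl))
    }
    where
    open SquareLeaf q
    covers : Split α β γ δ t u → ∃[ x ] (x ∈ t ∷ u ∷ [] × β ∈ corners x)
    covers (diag-αγ (_ ∷ b ∷ _) _) = t , here refl , b
    covers (diag-βδ (b ∷ _) _) = t , here refl , b
    covers-succ : Split α β γ δ t u → ∃[ x ] (x ∈ t ∷ u ∷ [] × γ ∈ corners x)
    covers-succ (diag-αγ (_ ∷ _ ∷ c ∷ []) _) = t , here refl , c
    covers-succ (diag-βδ (_ ∷ c ∷ _) _) = t , here refl , c

  rotate-unique₃ : ∀ {x y z : Fin m} → Unique (x ∷ y ∷ z ∷ []) → Unique (y ∷ z ∷ x ∷ [])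
  rotate-unique₃ ((xy ∷ xz ∷ []) ∷ (yz ∷ []) ∷ [] ∷ []) = (yz ∷ xy ∘ sym ∷ []) ∷ (xz ∘ sym ∷ []) ∷ [] ∷ []

  rotate-unique : ∀ {w x y z : Fin m} → Unique (w ∷ x ∷ y ∷ z ∷ []) → Unique (x ∷ y ∷ z ∷ w ∷ [])
  rotate-unique ((wx ∷ wy ∷ wz ∷ []) ∷ (xy ∷ xz ∷ []) ∷ (yz ∷ []) ∷ [] ∷ []) =
    (xy ∷ xz ∷ wx ∘ sym ∷ []) ∷ (yz ∷ wy ∘ sym ∷ []) ∷ (wz ∘ sym ∷ []) ∷ [] ∷ []

  -- Rotation interchanges the two kinds of diagonal. Out of `diag-αγ` it also exchanges the roles
  -- of `t` and `u`, hence the sum.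
  rotate-split : ∀ {α β γ δ t u} → Split α β γ δ t u ⊎ Split α β γ δ u t → Split β γ δ α t u ⊎ Split β γ δ α u t
  rotate-split = [ rotate , swap ∘ rotate ]′
    where
    rotate : ∀ {α β γ δ t u} → Split α β γ δ t u → Split β γ δ α t u ⊎ Split β γ δ α u t
    rotate (diag-αγ (a ∷ b ∷ c ∷ []) (a′ ∷ c′ ∷ d ∷ [])) = inj₂ (diag-βδ (c′ ∷ d ∷ a′ ∷ []) (b ∷ c ∷ a ∷ []))
    rotate (diag-βδ (b ∷ c ∷ d ∷ []) (a ∷ b′ ∷ d′ ∷ [])) = inj₁ (diag-αγ (b ∷ c ∷ d ∷ []) (b′ ∷ d′ ∷ a ∷ []))

-- The dual tree

module Apexes {n} (T : Triangulation (suc n)) where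
  open Triangulation T using (m≥2; unique; complete; count)
  open Geometry T

  last : Fin (suc n)
  last = fromℕ n

  0<n : 0 < n
  0<n = ≤-pred m≥2

  v₂<last : ∀ (t : TriangleOf T) → toℕ (v₂ t) < n
  v₂<last t = <-≤-trans (v₂<v₃ t) (toℕ≤ (v₃ t))

  -- Middle vertices determine their triangles, and there are as many triangles
  -- as vertices other than the first and the last.
  middle-triangle : ∀ {j : Fin (suc n)} → 0 < toℕ j → toℕ j < n → Σ (TriangleOf T) λ t → v₂ t ≡ j
  middle-triangle {j} 0<j j<n with unique∧⊆⇒⊇ vertices! (λ _ → ∈-allFin _) enough (∈-allFin j)
    where
    middles : List (Fin (suc n))
    middles = map v₂ (triangles T)
    vertices! : Unique (Fin.zero ∷ last ∷ middles)
    vertices! =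
      ((λ e → <⇒≢ 0<n (trans (cong toℕ e) (toℕ-fromℕ n)))
        ∷ All.map⁺ (All.universal (λ t e → n≮0 (subst (λ z → toℕ (v₁ t) < toℕ z) (sym e) (v₁<v₂ t))) (triangles T)))
      ∷ All.map⁺ (All.universal (λ t e → <⇒≢ (v₂<last t) (trans (cong toℕ (sym e)) (toℕ-fromℕ n))) (triangles T))
      ∷ Unique.map⁺ (v₂-injective _ _) unique
    enough : length (allFin (suc n)) ≤ 2 + length middles
    enough = ≤-reflexive (trans (length-tabulate {n = suc n} id)
      (sym (trans (cong (λ l → 2 + l) (trans (length-map v₂ (triangles T)) count)) (two 0<n))))
      where
      two : ∀ {n} → 0 < n → 2 + (suc n ∸ 2) ≡ suc n
      two (s≤s z≤n) = refl
  ... | here e = contradiction (cong toℕ (sym e)) (<⇒≢ 0<j)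
  ... | there (here e) = contradiction (trans (cong toℕ e) (toℕ-fromℕ n)) (<⇒≢ j<n)
  ... | there (there j∈) with ∈-map⁻ v₂ j∈
  ... | t , _ , e = t , sym e

  -- The triangle with middle vertex j has first vertex i; if its last vertex
  -- is not yet k, then that vertex takes over the role of j.
  apex-from : ∀ f {i j k : Fin (suc n)} → toℕ k ≤ f + toℕ j → E i j → E i k → i Fin.< j → j Fin.< k →
              Σ (TriangleOf T) λ t → v₁ t ≡ i × v₃ t ≡ k
  apex-from zero h _ _ _ j<k = contradiction h (<⇒≱ j<k)
  apex-from (suc f) {i} {j} {k} h ij ik i<j j<k
    with middle-triangle (≤-<-trans z≤n i<j) (<-≤-trans j<k (toℕ≤ k))
  ... | t , refl with <-cmp (toℕ (v₁ t)) (toℕ i) | <-cmp (toℕ (v₃ t)) (toℕ k)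
  -- Each deviation is a crossing: a start before `i` or an end after `k` crosses `i`-`k`, and a
  -- start after `i` crosses `i`-`j`.
  ... | tri< lt _ _ | _ = ⊥-elim (edge-noncrossing (e₁₂ t) ik lt i<j j<k)
  ... | tri> _ _ gt | _ = ⊥-elim (edge-noncrossing ij (e₁₃ t) gt (v₁<v₂ t) (v₂<v₃ t))
  ... | tri≈ _ _ _ | tri> _ _ gt = ⊥-elim (edge-noncrossing ik (e₂₃ t) i<j j<k gt)
  ... | tri≈ _ e _ | tri≈ _ e′ _ = t , toℕ-injective e , toℕ-injective e′
  ... | tri≈ _ e _ | tri< lt _ _ =
    apex-from f (≤-trans h (subst (_≤ f + toℕ (v₃ t)) (+-suc f (toℕ j)) (+-monoʳ-≤ f (v₂<v₃ t))))
      (subst (λ z → E z (v₃ t)) (toℕ-injective e) (e₁₃ t)) ik (<-trans i<j (v₂<v₃ t)) lt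

  apex : ∀ {x y} → E x y → x Fin.< y → toℕ y ≡ suc (toℕ x) ⊎ Σ (TriangleOf T) λ t → v₁ t ≡ x × v₃ t ≡ y
  apex {x} {y} xy x<y with m≤n⇒m<n∨m≡n x<y
  ... | inj₂ e = inj₁ (sym e)
  -- The climb starts from the side joining `x` to its successor.
  ... | inj₁ lt = inj₂ (apex-from (toℕ y) {j = x⁺} (m≤m+n _ _) (inj₁ (inj₁ (side-step x⁺≡))) xy
                    (subst (toℕ x <_) (sym x⁺≡) (n<1+n _)) (subst (_< toℕ y) (sym x⁺≡) lt))
    where
    x⁺ : Fin (suc n)
    x⁺ = fromℕ< (<-trans lt (toℕ<n y))
    x⁺≡ : toℕ x⁺ ≡ suc (toℕ x)
    x⁺≡ = toℕ-fromℕ< (<-trans lt (toℕ<n y))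

  v₁₃-injective : ∀ t u → v₁ t ≡ v₁ u → v₃ t ≡ v₃ u → t ≡ u
  v₁₃-injective t u e e′ with <-cmp (toℕ (v₂ t)) (toℕ (v₂ u))
  ... | tri≈ _ eq _ = v₂-injective t u (toℕ-injective eq)
  ... | tri< lt _ _ = ⊥-elim (edge-noncrossing (e₁₂ u) (e₂₃ t)
          (subst (λ z → toℕ z < toℕ (v₂ t)) e (v₁<v₂ t)) lt (subst (λ z → toℕ (v₂ u) < toℕ z) (sym e′) (v₂<v₃ u)))
  ... | tri> _ _ gt = ⊥-elim (edge-noncrossing (e₁₂ t) (e₂₃ u)
          (subst (λ z → toℕ z < toℕ (v₂ u)) (sym e) (v₁<v₂ u)) gt (subst (λ z → toℕ (v₂ t) < toℕ z) e′ (v₂<v₃ t)))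

  -- The long edges would cross. This forbids an edge from being the first edge of one triangle and
  -- the second edge of another, that is, from hanging below two parents.
  no-staircase : ∀ t u → v₁ t ≡ v₂ u → v₂ t ≡ v₃ u → ⊥
  no-staircase t u e e′ = edge-noncrossing (e₁₃ u) (e₁₃ t)
    (subst (λ z → toℕ (v₁ u) < toℕ z) (sym e) (v₁<v₂ u))
    (subst (λ z → toℕ (v₁ t) < toℕ z) e′ (v₁<v₂ t)) (subst (λ z → toℕ z < toℕ (v₃ t)) e′ (v₂<v₃ t))

  -- The dual tree, rooted at the triangle on the side joining the first and
  -- the last vertex.
  data Child (p c : TriangleOf T) : Set where
    left  : v₁ p ≡ v₁ c → v₂ p ≡ v₃ c → Child p c
    right : v₂ p ≡ v₁ c → v₃ p ≡ v₃ c → Child p c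

  parent-unique : ∀ {p q c} → Child p c → Child q c → p ≡ q
  parent-unique (left _ a) (left _ b) = v₂-injective _ _ (trans a (sym b))
  parent-unique {p} {q} (left a b) (right c d) = ⊥-elim (no-staircase p q (trans a (sym c)) (trans b (sym d)))
  parent-unique {p} {q} (right a b) (left c d) = ⊥-elim (no-staircase q p (trans c (sym a)) (trans d (sym b)))
  parent-unique (right a _) (right b _) = v₂-injective _ _ (trans a (sym b))

  child-v₁ : ∀ {p c} → Child p c → toℕ (v₁ p) ≤ toℕ (v₁ c)
  child-v₁ (left a _) = ≤-reflexive (cong toℕ a)
  child-v₁ {p} (right a _) = <⇒≤ (subst (λ z → toℕ (v₁ p) < toℕ z) a (v₁<v₂ p))

  child-asym : ∀ {p c} → Child p c → Child c p → ⊥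
  child-asym {p} {c} (left a b) q with q
  ... | left _ d = <-asym (subst (λ z → toℕ z < toℕ (v₃ p)) b (v₂<v₃ p)) (subst (λ z → toℕ z < toℕ (v₃ c)) d (v₂<v₃ c))
  ... | right _ d = <⇒≢ (subst (λ z → toℕ z < toℕ (v₃ p)) b (v₂<v₃ p)) (cong toℕ d)
  child-asym {p} {c} (right a _) q = <⇒≱ (subst (λ z → toℕ (v₁ p) < toℕ z) a (v₁<v₂ p)) (child-v₁ q)

  -- An edge is the long edge of at most one triangle and a short edge of at most one, so a shared
  -- edge is long in one and short in the other.
  pairs⇒child : ∀ {t u x y} → t ≢ u → Pair t x y → Pair u x y → Child t u ⊎ Child u t
  pairs⇒child {t} {u} t≢u = from-pairs
    where
    from-pairs : ∀ {x y} → Pair t x y → Pair u x y → Child t u ⊎ Child u t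
    from-pairs (pair₁₂ refl refl) (pair₁₂ _ b) = contradiction (v₂-injective t u b) t≢u
    from-pairs (pair₁₂ refl refl) (pair₂₃ a b) = ⊥-elim (no-staircase t u a b)
    from-pairs (pair₁₂ refl refl) (pair₁₃ a b) = inj₁ (left a b)
    from-pairs (pair₂₃ refl refl) (pair₁₂ a b) = ⊥-elim (no-staircase u t (sym a) (sym b))
    from-pairs (pair₂₃ refl refl) (pair₂₃ a _) = contradiction (v₂-injective t u a) t≢u
    from-pairs (pair₂₃ refl refl) (pair₁₃ a b) = inj₁ (right a b)
    from-pairs (pair₁₃ refl refl) (pair₁₂ a b) = inj₂ (left (sym a) (sym b))
    from-pairs (pair₁₃ refl refl) (pair₂₃ a b) = inj₂ (right (sym a) (sym b))
    from-pairs (pair₁₃ refl refl) (pair₁₃ a b) = contradiction (v₁₃-injective t u a b) t≢u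

  adjacent⇒child : ∀ {t u x y} → t ≢ u → x ≢ y → x ∈ corners t → y ∈ corners t → x ∈ corners u → y ∈ corners u →
                   Child t u ⊎ Child u t
  adjacent⇒child {t} {u} {x} {y} t≢u x≢y xt yt xu yu with <-cmp (toℕ x) (toℕ y)
  ... | tri< lt _ _ = pairs⇒child t≢u (pair t xt yt lt) (pair u xu yu lt)
  ... | tri≈ _ e _ = contradiction (toℕ-injective e) x≢y
  ... | tri> _ _ gt = pairs⇒child t≢u (pair t yt xt gt) (pair u yu xu gt)

  -- The subtree below the edge `x`-`y`, described by positions instead of paths in the tree.
  Within : Fin (suc n) → Fin (suc n) → TriangleOf T → Set
  Within x y u = toℕ x ≤ toℕ (v₁ u) × toℕ (v₃ u) ≤ toℕ y

  within-≤ : ∀ {x y u v} → Within x y u → v ∈ corners u → toℕ x ≤ toℕ v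
  within-≤ (le , _) (here refl) = le
  within-≤ {u = u} (le , _) (there (here refl)) = ≤-trans le (<⇒≤ (v₁<v₂ u))
  within-≤ {u = u} (le , _) (there (there (here refl))) = ≤-trans le (<⇒≤ (v₁<v₃ u))

  within-≥ : ∀ {x y u v} → Within x y u → v ∈ corners u → toℕ v ≤ toℕ y
  within-≥ {u = u} (_ , ge) (here refl) = ≤-trans (<⇒≤ (v₁<v₃ u)) ge
  within-≥ {u = u} (_ , ge) (there (here refl)) = ≤-trans (<⇒≤ (v₂<v₃ u)) ge
  within-≥ (_ , ge) (there (there (here refl))) = ge

  within⇒disjoint : ∀ {p q r s X Y} → toℕ q ≤ toℕ r → All (Within p q) X → All (Within r s) Y → Disjoint X Y
  within⇒disjoint q≤r wX wY {t} (t∈X , t∈Y) with All.lookup wX t∈X | All.lookup wY t∈Y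
  ... | _ , le | ge , _ = <⇒≱ (v₁<v₃ t) (≤-trans le (≤-trans q≤r ge))

  outside⇒disjoint : ∀ {p q X Y} → All (¬_ ∘ Within p q) X → All (Within p q) Y → Disjoint X Y
  outside⇒disjoint oX wY (t∈X , t∈Y) = All.lookup oX t∈X (All.lookup wY t∈Y)

-- The search for two disjoint leaves

sorted⇒unique : ∀ {m} {w x y z : Fin m} → w Fin.< x → x Fin.< y → y Fin.< z → Unique (w ∷ x ∷ y ∷ z ∷ [])
sorted⇒unique wx xy yz =
  (ne wx ∷ ne (<-trans wx xy) ∷ ne (<-trans wx (<-trans xy yz)) ∷ [])
  ∷ (ne xy ∷ ne (<-trans xy yz) ∷ []) ∷ (ne yz ∷ []) ∷ [] ∷ []
  where
  ne : ∀ {m} {i j : Fin m} → i Fin.< j → i ≢ j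
  ne lt e = <⇒≢ lt (cong toℕ e)

module Leaves {m} {T : Triangulation m} {a : Labelling T} (A : Admissible T a) where
  open Pieces T

  data Leaf : List (TriangleOf T) → Set where
    ear    : ∀ {t} → Ear t → Unit (a t) → Leaf (t ∷ [])
    square : ∀ {t u} → Square A t u → SquareLeaf t u → Leaf (t ∷ u ∷ [])

  square-leaf : ∀ {P : TriangleOf T → Set} {t u α β γ δ} → Square A t u → β ≡ succ α → γ ≡ succ β → δ ≡ succ γ →
                Unique (α ∷ β ∷ γ ∷ δ ∷ []) → Split α β γ δ t u ⊎ Split α β γ δ u t → P t → P u →
                ∃[ X ] (Leaf X × All P X)
  square-leaf sq b c d chain! (inj₁ s) pt pu =
    _ , square sq record { β≡ = b ; γ≡ = c ; δ≡ = d ; chain! = chain! ; split = s } , pt ∷ pu ∷ []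
  square-leaf sq b c d chain! (inj₂ s) pt pu =
    _ , square (Admissible.symmetric A sq) record { β≡ = b ; γ≡ = c ; δ≡ = d ; chain! = chain! ; split = s } ,
    pu ∷ pt ∷ []

module Search {n} (T : Triangulation (suc n)) {a : Labelling T} (A : Admissible T a) where
  open Geometry T
  open Apexes T
  open Leaves A
  open Pieces T
  private module A = Admissible A

  -- By adjacent⇒child, the partner of t is then a child of t.
  Downward : TriangleOf T → Set
  Downward t = ∀ {u} → A.Square t u → ¬ Child u t

  -- What lies beyond an edge leaving a piece: nothing, for a side of the polygon, or a child from
  -- which the descent can continue without cutting a square.
  data Gap (x y : Fin (suc n)) : Set where
    unit   : toℕ y ≡ suc (toℕ x) → Gap x y
    filled : ∀ c → v₁ c ≡ x → v₃ c ≡ y → Downward c → Gap x y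

  gap : ∀ {x y} → E x y → x Fin.< y → (∀ c → v₁ c ≡ x → v₃ c ≡ y → Downward c) → Gap x y
  gap xy x<y down with apex xy x<y
  ... | inj₁ e = unit e
  ... | inj₂ (c , e , e′) = filled c e e′ (down c e e′)

  -- The unit triangle or the square containing t, with the edges leading to
  -- its children.
  data Piece (t : TriangleOf T) : Set where
    single : Unit (a t) → Gap (v₁ t) (v₂ t) → Gap (v₂ t) (v₃ t) → Piece t
    double : ∀ {x y u} → A.Square u t → Within (v₁ t) (v₃ t) u → v₁ t Fin.< x → x Fin.< y → y Fin.< v₃ t →
             Split (v₁ t) x y (v₃ t) u t → Gap (v₁ t) x → Gap x y → Gap y (v₃ t) → Piece t

  module _ {t : TriangleOf T} where

    -- This and the next two lemmas rest on unique parents: a square joining `c` to its parent would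
    -- use a triangle that is unit-labelled or already has another partner.
    unit-child : Unit (a t) → ∀ {c} → Child t c → Downward c
    unit-child ut tc sq uc with refl ← parent-unique uc tc = unsquared A (A.symmetric sq) ut

    partner-child : ∀ {u} → A.Square t u → Child t u → ∀ {c} → Child u c → Downward c
    partner-child sq tu uc sq′ qc with refl ← parent-unique qc uc =
      child-asym tu (subst (Child _) (sym (partner-unique A (A.symmetric sq) (A.symmetric sq′))) uc)

    sibling : ∀ {u} → A.Square t u → ∀ {c} → Child t c → c ≢ u → Downward c
    sibling sq tc c≢u sq′ qc with refl ← parent-unique qc tc = c≢u (partner-unique A (A.symmetric sq′) sq)

    single-piece : Unit (a t) → Piece t
    single-piece ut = single ut
      (gap (e₁₂ t) (v₁<v₂ t) (λ c e e′ → unit-child ut (left (sym e) (sym e′))))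
      (gap (e₂₃ t) (v₂<v₃ t) (λ c e e′ → unit-child ut (right (sym e) (sym e′))))

    -- The inner vertices `x`, `y` of the quadrilateral are the middle vertices of `u` and `t`, in
    -- this order for a left child and reversed for a right one. The child stands first in `Split`,
    -- being the one that the diagonal cuts off below.
    double-piece : ∀ {u} → A.Square t u → Child t u → Piece t
    double-piece {u} sq tu@(left e e′) = double (A.symmetric sq)
      (≤-reflexive (cong toℕ e) , subst (λ z → toℕ z ≤ toℕ (v₃ t)) e′ (<⇒≤ (v₂<v₃ t)))
      (subst (λ z → toℕ z < toℕ (v₂ u)) (sym e) (v₁<v₂ u))
      (subst (λ z → toℕ (v₂ u) < toℕ z) (sym e′) (v₂<v₃ u)) (v₂<v₃ t)
      (diag-αγ (here e ∷ there (here refl) ∷ there (there (here e′)) ∷ [])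
               (here refl ∷ there (here refl) ∷ there (there (here refl)) ∷ []))
      (gap (subst (λ z → E z (v₂ u)) (sym e) (e₁₂ u)) (subst (λ z → toℕ z < toℕ (v₂ u)) (sym e) (v₁<v₂ u))
        (λ c f f′ → partner-child sq tu (left (trans (sym e) (sym f)) (sym f′))))
      (gap (subst (E (v₂ u)) (sym e′) (e₂₃ u)) (subst (λ z → toℕ (v₂ u) < toℕ z) (sym e′) (v₂<v₃ u))
        (λ c f f′ → partner-child sq tu (right (sym f) (trans (sym e′) (sym f′)))))
      (gap (e₂₃ t) (v₂<v₃ t)
        (λ c f f′ → sibling sq (right (sym f) (sym f′))
          (λ { refl → <⇒≢ (v₁<v₂ t) (cong toℕ (trans e f)) })))
    double-piece {u} sq tu@(right e e′) = double (A.symmetric sq)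
      (subst (λ z → toℕ (v₁ t) ≤ toℕ z) e (<⇒≤ (v₁<v₂ t)) , ≤-reflexive (cong toℕ (sym e′)))
      (v₁<v₂ t) (subst (λ z → toℕ z < toℕ (v₂ u)) (sym e) (v₁<v₂ u))
      (subst (λ z → toℕ (v₂ u) < toℕ z) (sym e′) (v₂<v₃ u))
      (diag-βδ (here e ∷ there (here refl) ∷ there (there (here e′)) ∷ [])
               (here refl ∷ there (here refl) ∷ there (there (here refl)) ∷ []))
      (gap (e₁₂ t) (v₁<v₂ t)
        (λ c f f′ → sibling sq (left (sym f) (sym f′))
          (λ { refl → <⇒≢ (v₁<v₂ t) (cong toℕ (trans (sym f) (sym e))) })))
      (gap (subst (λ z → E z (v₂ u)) (sym e) (e₁₂ u)) (subst (λ z → toℕ z < toℕ (v₂ u)) (sym e) (v₁<v₂ u))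
        (λ c f f′ → partner-child sq tu (left (trans (sym e) (sym f)) (sym f′))))
      (gap (subst (E (v₂ u)) (sym e′) (e₂₃ u)) (subst (λ z → toℕ (v₂ u) < toℕ z) (sym e′) (v₂<v₃ u))
        (λ c f f′ → partner-child sq tu (right (sym f) (trans (sym e′) (sym f′)))))

  piece : ∀ t → Downward t → Piece t
  piece t down with a t ℤ.≟ 1ℤ | a t ℤ.≟ -1ℤ
  ... | yes e | _ = single-piece (inj₁ e)
  ... | no _ | yes e = single-piece (inj₂ e)
  ... | no ≢1 | no ≢-1 with A.partition t ≢1 ≢-1
  ... | u , sq , _ with A.adjacent sq
  ... | _ , _ , x≢y , xt , yt , xu , yu with adjacent⇒child (A.distinct sq) x≢y xt yt xu yu
  ... | inj₁ tu = double-piece sq tu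
  ... | inj₂ ut = contradiction ut (down sq)

  LeafWithin : Fin (suc n) → Fin (suc n) → Set
  LeafWithin x y = ∃[ X ] (Leaf X × All (Within x y) X)

  widen : ∀ {x y x′ y′} → toℕ x ≤ toℕ x′ → toℕ y′ ≤ toℕ y → LeafWithin x′ y′ → LeafWithin x y
  widen le ge (X , l , w) = X , l , All.map (λ (p , q) → ≤-trans le p , ≤-trans q ge) w

  -- The fuel bounds the width of `t`, and every filled gap leads to a strictly narrower triangle. A
  -- piece whose gaps are all sides is a leaf.
  leaf-below : ∀ f t → toℕ (v₃ t) ≤ f + toℕ (v₁ t) → Downward t → LeafWithin (v₁ t) (v₃ t)
  leaf-below zero t h _ = contradiction h (<⇒≱ (v₁<v₃ t))
  leaf-below (suc f) t h down = from-piece (piece t down)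
    where
    shrink-left : ∀ c → Downward c → v₁ t Fin.< v₁ c → toℕ (v₃ c) ≤ toℕ (v₃ t) → LeafWithin (v₁ t) (v₃ t)
    shrink-left c down lt le = widen (<⇒≤ lt) le (leaf-below f c
      (≤-trans le (≤-trans h (subst (_≤ f + toℕ (v₁ c)) (+-suc f (toℕ (v₁ t))) (+-monoʳ-≤ f lt)))) down)
    shrink-right : ∀ c → Downward c → toℕ (v₁ t) ≤ toℕ (v₁ c) → v₃ c Fin.< v₃ t → LeafWithin (v₁ t) (v₃ t)
    shrink-right c down le lt = widen le (<⇒≤ lt) (leaf-below f c
      (≤-trans (≤-pred (≤-trans lt h)) (+-monoʳ-≤ f le)) down)
    from-piece : Piece t → LeafWithin (v₁ t) (v₃ t)
    from-piece (single _ (filled c refl e down) _) =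
      shrink-right c down ≤-refl (subst (λ z → toℕ z < toℕ (v₃ t)) (sym e) (v₂<v₃ t))
    from-piece (single _ (unit _) (filled c e refl down)) =
      shrink-left c down (subst (λ z → toℕ (v₁ t) < toℕ z) (sym e) (v₁<v₂ t)) ≤-refl
    from-piece (single ut (unit e) (unit e′)) = t ∷ [] , ear record
      { β≡ = side-step e
      ; γ≡ = side-step e′
      ; chain! = corners-unique t
      ; chain⊆ = here refl ∷ there (here refl) ∷ there (there (here refl)) ∷ []
      } ut , (≤-refl , ≤-refl) ∷ []
    from-piece (double _ _ _ xy yz _ (filled c e refl down) _ _) =
      shrink-right c down (≤-reflexive (cong toℕ (sym e))) (<-trans xy yz)
    from-piece (double _ _ wx xy yz _ (unit _) (filled c refl refl down) _) =
      shrink-right c down (<⇒≤ wx) yz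
    from-piece (double _ _ wx xy _ _ (unit _) (unit _) (filled c refl e down)) =
      shrink-left c down (<-trans wx xy) (≤-reflexive (cong toℕ e))
    from-piece (double sq wu wx xy yz s (unit e) (unit e′) (unit e″)) =
      square-leaf sq (side-step e) (side-step e′) (side-step e″) (sorted⇒unique wx xy yz) (inj₁ s) wu (≤-refl , ≤-refl)

  gap-leaf : ∀ {x y} c → v₁ c ≡ x → v₃ c ≡ y → Downward c → LeafWithin x y
  gap-leaf c refl refl down = leaf-below (toℕ (v₃ c)) c (m≤m+n _ _) down

  lone-square : ∀ {t u} → A.Square t u → length (triangles T) ≢ 2
  lone-square {t} {u} sq len with ∈⇒↭ (Triangulation.complete T t)
  ... | ys , p with ∈-resp-↭ p (Triangulation.complete T u) | trans (sym len) (↭-length p)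
  lone-square sq len | _ , p | here refl | _ = A.distinct sq refl
  lone-square sq len | _ ∷ [] , p | there (here refl) | _ =
    contradiction (subst (4 ∣_) (trans (total-↭ a p) (total-square A sq [])) (even⇒4∣total T a (proj₂ A.d-even)))
                  (from-no (4 ∣? 2))
  lone-square sq len | _ ∷ _ ∷ _ , p | there _ | ()

  TwoLeaves : Set
  TwoLeaves = ∃₂ λ X Y → Leaf X × Leaf Y × Disjoint X Y

  within-leaves : ∀ {p q r s} → toℕ q ≤ toℕ r → LeafWithin p q → LeafWithin r s → TwoLeaves
  within-leaves q≤r (X , l , w) (Y , l′ , w′) = X , Y , l , l′ , within⇒disjoint q≤r w w′

  outside-leaf : ∀ {p q} → ∃[ X ] (Leaf X × All (¬_ ∘ Within p q) X) → LeafWithin p q → TwoLeaves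
  outside-leaf (X , l , o) (Y , l′ , w) = X , Y , l , l′ , outside⇒disjoint o w

  before : ∀ {p q u v} → v ∈ corners u → v Fin.< p → ¬ Within p q u
  before {u = u} v∈ lt w = <⇒≱ lt (within-≤ {u = u} w v∈)

  beyond : ∀ {p q u v} → v ∈ corners u → q Fin.< v → ¬ Within p q u
  beyond {u = u} v∈ lt w = <⇒≱ lt (within-≥ {u = u} w v∈)

  -- The remaining edge of the root piece is the side from last to first vertex. Two filled gaps
  -- yield leaves in disjoint intervals. With exactly one, the root piece is itself the second leaf.
  -- With none, the polygon would be a triangle or a lone square.
  module Root (3≤n : 3 ≤ n) (t : TriangleOf T) (v₁≡0 : toℕ (v₁ t) ≡ 0) (v₃≡n : toℕ (v₃ t) ≡ n) where

    wrap : v₁ t ≡ succ (v₃ t)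
    wrap = next⇒succ (inj₂ (v₃≡n , v₁≡0))

    downward : Downward t
    downward {u} _ (left _ e) = <⇒≱ (v₂<last u) (≤-reflexive (trans (sym v₃≡n) (cong toℕ (sym e))))
    downward {u} _ (right e _) = n≮0 (subst (toℕ (v₁ u) <_) (trans (cong toℕ e) v₁≡0) (v₁<v₂ u))

    from-piece : Piece t → TwoLeaves
    from-piece (single _ (filled c e e′ down) (filled c₁ e₁ e₁′ down₁)) =
      within-leaves ≤-refl (gap-leaf c e e′ down) (gap-leaf c₁ e₁ e₁′ down₁)
    -- The tip is `v₁ t`, entered from `v₃ t` across the wrap-around side.
    from-piece (single ut (unit e) (filled c f f′ down)) = outside-leaf (_ , ear record
      { β≡ = wrap
      ; γ≡ = side-step e
      ; chain! = rotate-unique₃ (rotate-unique₃ (corners-unique t))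
      ; chain⊆ = there (there (here refl)) ∷ here refl ∷ there (here refl) ∷ []
      } ut , before {u = t} (here refl) (v₁<v₂ t) ∷ []) (gap-leaf c f f′ down)
    from-piece (single ut (filled c f f′ down) (unit e)) = outside-leaf (_ , ear record
      { β≡ = side-step e
      ; γ≡ = wrap
      ; chain! = rotate-unique₃ (corners-unique t)
      ; chain⊆ = there (here refl) ∷ there (there (here refl)) ∷ here refl ∷ []
      } ut , beyond {u = t} (there (there (here refl))) (v₂<v₃ t) ∷ []) (gap-leaf c f f′ down)
    from-piece (single _ (unit e) (unit e′)) =
      contradiction (trans (sym v₃≡n) (trans e′ (cong suc (trans e (cong suc v₁≡0))))) (<⇒≢ 3≤n ∘ sym)
    from-piece (double _ _ _ _ _ _ (filled c e e′ down) (filled c₁ e₁ e₁′ down₁) _) =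
      within-leaves ≤-refl (gap-leaf c e e′ down) (gap-leaf c₁ e₁ e₁′ down₁)
    from-piece (double _ _ _ xy _ _ (filled c e e′ down) (unit _) (filled c₁ e₁ e₁′ down₁)) =
      within-leaves (<⇒≤ xy) (gap-leaf c e e′ down) (gap-leaf c₁ e₁ e₁′ down₁)
    from-piece (double _ _ _ _ _ _ (unit _) (filled c e e′ down) (filled c₁ e₁ e₁′ down₁)) =
      within-leaves ≤-refl (gap-leaf c e e′ down) (gap-leaf c₁ e₁ e₁′ down₁)
    -- In this and the next two clauses the quadrilateral is rotated until the filled gap joins its
    -- last vertex to its first, leaving a chain of three sides.
    from-piece (double {x} {y} {u} sq _ wx xy yz s (filled c f f′ down) (unit e′) (unit e″)) =
      outside-leaf (square-leaf sq (side-step e′) (side-step e″) wrap (rotate-unique (sorted⇒unique wx xy yz))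
        (rotate-split (inj₁ s)) (proj₁ (outside s)) (proj₂ (outside s))) (gap-leaf c f f′ down)
      where
      outside : Split (v₁ t) x y (v₃ t) u t → ¬ Within (v₁ t) x u × ¬ Within (v₁ t) x t
      outside (diag-αγ (_ ∷ _ ∷ y∈ ∷ []) (_ ∷ _ ∷ z∈ ∷ [])) = beyond {u = u} y∈ xy , beyond {u = t} z∈ (<-trans xy yz)
      outside (diag-βδ (_ ∷ _ ∷ z∈ ∷ []) (_ ∷ _ ∷ z∈′ ∷ [])) =
        beyond {u = u} z∈ (<-trans xy yz) , beyond {u = t} z∈′ (<-trans xy yz)
    from-piece (double {x} {y} {u} sq _ wx xy yz s (unit e) (filled c f f′ down) (unit e″)) =
      outside-leaf (square-leaf sq (side-step e″) wrap (side-step e) (rotate-unique (rotate-unique (sorted⇒unique wx xy yz)))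
        (rotate-split (rotate-split (inj₁ s))) (proj₁ (outside s)) (proj₂ (outside s))) (gap-leaf c f f′ down)
      where
      outside : Split (v₁ t) x y (v₃ t) u t → ¬ Within x y u × ¬ Within x y t
      outside (diag-αγ (w∈ ∷ _) (w∈′ ∷ _)) = before {u = u} w∈ wx , before {u = t} w∈′ wx
      outside (diag-βδ (_ ∷ _ ∷ z∈ ∷ []) (w∈ ∷ _)) = beyond {u = u} z∈ yz , before {u = t} w∈ wx
    from-piece (double {x} {y} {u} sq _ wx xy yz s (unit e) (unit e′) (filled c f f′ down)) =
      outside-leaf (square-leaf sq wrap (side-step e) (side-step e′)
        (rotate-unique (rotate-unique (rotate-unique (sorted⇒unique wx xy yz))))
        (rotate-split (rotate-split (rotate-split (inj₁ s)))) (proj₁ (outside s)) (proj₂ (outside s))) (gap-leaf c f f′ down)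
      where
      outside : Split (v₁ t) x y (v₃ t) u t → ¬ Within y (v₃ t) u × ¬ Within y (v₃ t) t
      outside (diag-αγ (w∈ ∷ _) (w∈′ ∷ _)) = before {u = u} w∈ (<-trans wx xy) , before {u = t} w∈′ (<-trans wx xy)
      outside (diag-βδ (x∈ ∷ _) (w∈ ∷ _)) = before {u = u} x∈ xy , before {u = t} w∈ (<-trans wx xy)
    from-piece (double sq _ _ _ _ _ (unit e) (unit e′) (unit e″)) =
      contradiction (trans (Triangulation.count T) (cong (λ k → suc k ∸ 2) n≡3)) (lone-square sq)
      where
      n≡3 : n ≡ 3
      n≡3 = trans (sym v₃≡n) (trans e″ (cong suc (trans e′ (cong suc (trans e (cong suc v₁≡0))))))

  two-leaves : 3 ≤ n → TwoLeaves
  two-leaves 3≤n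
    with apex {Fin.zero} {last} (inj₁ (inj₂ (next⇒succ (inj₂ (toℕ-fromℕ n , refl)))))
                                (subst (0 <_) (sym (toℕ-fromℕ n)) 0<n)
  ... | inj₁ e = contradiction (subst (3 ≤_) (trans (sym (toℕ-fromℕ n)) e) 3≤n) λ { (s≤s ()) }
  ... | inj₂ (t , e , e′) = from-piece (piece t downward)
    where open Root 3≤n t (cong toℕ e) (trans (cong toℕ e′) (toℕ-fromℕ n))

-- Parity arithmetic and the case distinction

2∣k⊎2∣1+k : ∀ k → 2 ∣ k ⊎ 2 ∣ suc k
2∣k⊎2∣1+k zero = inj₁ (divides 0 refl)
2∣k⊎2∣1+k (suc k) with 2∣k⊎2∣1+k k
... | inj₁ p = inj₂ (∣m∣n⇒∣m+n ∣-refl p)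
... | inj₂ p = inj₁ p

-- For a polygon with `4 + r` vertices, removing a square leaves `r` triangles of weight 2 each in
-- `4∣negated`; the last 2 is the weight of the square. In `even⇒4∣`, removing an ear leaves `1 + r`
-- triangles, and the 2 is the weight of the label -1.
odd⇒4∣ : ∀ r → ¬ 2 ∣ 4 + r → 4 ∣ 2 * r + 2
odd⇒4∣ r odd with 2∣k⊎2∣1+k r
... | inj₁ p = contradiction (∣m∣n⇒∣m+n (divides 2 refl) p) odd
... | inj₂ p = subst (4 ∣_) (double r) (*-monoʳ-∣ 2 p)
  where
  double : ∀ r → 2 * (1 + r) ≡ 2 * r + 2
  double = solve-∀

even⇒4∣ : ∀ r → 2 ∣ 4 + r → 4 ∣ 2 * (1 + r) + 2
even⇒4∣ r even = ∣m+n∣m⇒∣n (subst (4 ∣_) (double r) (*-monoʳ-∣ 2 even)) ∣-refl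
  where
  double : ∀ r → 2 * (4 + r) ≡ 4 + (2 * (1 + r) + 2)
  double = solve-∀

weight≡0⇒1 : ∀ {c} → Unit c → 4 ∣ weight c + 0 → c ≡ 1ℤ
weight≡0⇒1 (inj₁ e) _ = e
weight≡0⇒1 (inj₂ refl) 4∣2 = contradiction 4∣2 (from-no (4 ∣? 2))

single-triangle : ∀ {m} (T : Triangulation m) (a : Labelling T) → Admissible T a → length (triangles T) ≡ 1 →
                  ∃[ t ] (triangles T ≡ t ∷ [] × a t ≡ 1ℤ)
single-triangle T a A len = go (triangles T) refl len
  where
  module A = Admissible A
  go : ∀ ts → triangles T ≡ ts → length ts ≡ 1 → ∃[ t ] (triangles T ≡ t ∷ [] × a t ≡ 1ℤ)
  go (t ∷ []) eq _ = t , eq , label (a t ℤ.≟ 1ℤ) (a t ℤ.≟ -1ℤ)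
    where
    only : ∀ u → u ≡ t
    only u with subst (u ∈_) eq (Triangulation.complete T u)
    ... | here e = e
    4∣weight : 4 ∣ weight (a t) + 0
    4∣weight = subst (λ ts → 4 ∣ total a ts) eq (even⇒4∣total T a (proj₂ A.d-even))
    label : Dec (a t ≡ 1ℤ) → Dec (a t ≡ -1ℤ) → a t ≡ 1ℤ
    label (yes e) _ = e
    label (no _) (yes e) = weight≡0⇒1 (inj₂ e) 4∣weight
    label (no ≢1) (no ≢-1) with A.partition t ≢1 ≢-1
    ... | u , sq , _ = contradiction (sym (only u)) (A.distinct sq)

module Conclusion {r} (T : Triangulation (4 + r)) (a : Labelling T) (A : Admissible T a) where
  open Pieces T
  open Leaves A

  square-at : ∀ {t u} → Square A t u → (q : SquareLeaf t u) → SquareAt T a A (SquareLeaf.β q) t u (a t)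
  square-at {t} {u} sq q = sq , square-corners q , refl ,
    trans (sym (neg-involutive (a u))) (cong -_ (sym (Admissible.opposite A sq)))

  swap₂ : ∀ {B : Set} {x y : B} {xs} → x ∷ y ∷ xs ⊆ y ∷ x ∷ xs
  swap₂ (here e) = there (here e)
  swap₂ (there (here e)) = here e
  swap₂ (there (there v∈)) = there (there v∈)

  ∷⁺ : ∀ {B : Set} {x : B} {xs ys} → xs ⊆ ys → x ∷ xs ⊆ x ∷ ys
  ∷⁺ s (here e) = here e
  ∷⁺ s (there v∈) = there (s v∈)

  positive-ear : ∀ {t} (e : Ear t) → a t ≡ 1ℤ → let k = Ear.β e in
    TriangleAt T a k t 1ℤ × RemovalAdmissible T a (k ∷ []) (t ∷ []) id (3 + r)
  positive-ear e eq = (ear-corners e , eq) ,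
    removal A q (unit-closed A (inj₁ eq ∷ [])) id-symmetry id id id id
      (4∣remaining A q (subst (λ c → 4 ∣ weight c + 0) (sym eq) (divides 0 refl)))
    where q = remove-ear no-reduction e λ ()

  negative-ear : 2 ∣ 4 + r → ∀ {t} (e : Ear t) → a t ≡ -1ℤ → let k = Ear.β e in
    TriangleAt T a k t -1ℤ × RemovalAdmissible T a (k ∷ []) (t ∷ []) -_ (3 + r)
  negative-ear even e eq = (ear-corners e , eq) ,
    removal A q (unit-closed A (inj₂ eq ∷ [])) neg-symmetry id id id id
      (4∣negated A q
        (subst (λ c → 4 ∣ 2 * (1 + r) + (weight c + 0)) (sym eq) (even⇒4∣ r even)))
    where q = remove-ear no-reduction e λ ()

  one-square : ¬ 2 ∣ 4 + r → ∀ {t u} → Square A t u → (q : SquareLeaf t u) → let k = SquareLeaf.β q in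
    SquareAt T a A k t u (a t) × RemovalAdmissible T a (k ∷ succ k ∷ []) (t ∷ u ∷ []) -_ (2 + r)
  one-square odd sq q with remove-square no-reduction q (Admissible.distinct A sq) (λ ()) (λ ())
  ... | _ , ρ , ⊆₁ , ⊇₁ = square-at sq q ,
    removal A ρ closed neg-symmetry ⊆₁ ⊇₁ swap₂ swap₂
      (4∣negated A ρ (subst (λ w → 4 ∣ 2 * r + w) (sym (total-square A us [])) (odd⇒4∣ r odd)))
    where
    -- The removed triangles are listed as `u ∷ t ∷ []`, latest first, hence the reversed square.
    us = Admissible.symmetric A sq
    closed = square-closed A us (λ _ ())

  two-ears : ∀ {t u} (e : Ear t) (f : Ear u) → Disjoint (t ∷ []) (u ∷ []) → a t ≡ -1ℤ → a u ≡ -1ℤ →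
    let j = Ear.β e ; k = Ear.β f in
    Apart j k × TriangleAt T a j t -1ℤ × TriangleAt T a k u -1ℤ
      × RemovalAdmissible T a (j ∷ k ∷ []) (t ∷ u ∷ []) id (2 + r)
  two-ears e f dis eq eq′ = tips-apart dis (ear-tip e) (ear-tip f) , (ear-corners e , eq) , (ear-corners f , eq′) ,
    removal A q closed id-symmetry id id id id
      -- Two labels -1 weigh 2 + 2, a single multiple of 4; two squares weigh the same below.
      (4∣remaining A q (subst₂ (λ c d → 4 ∣ weight c + (weight d + 0)) (sym eq) (sym eq′) (divides 1 refl)))
    where
    q = remove-ear (remove-ear no-reduction f λ ()) e (λ t∈ → dis (here refl , t∈))
    closed = unit-closed A (inj₂ eq ∷ inj₂ eq′ ∷ [])

  two-squares : ∀ {t u x y} → Square A t u → Square A x y → (p : SquareLeaf t u) (q : SquareLeaf x y) →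
    Disjoint (t ∷ u ∷ []) (x ∷ y ∷ []) → let j = SquareLeaf.β p ; k = SquareLeaf.β q in
    Apart j k × SquareAt T a A j t u (a t) × SquareAt T a A k x y (a x)
      × RemovalAdmissible T a (j ∷ succ j ∷ k ∷ succ k ∷ []) (t ∷ u ∷ x ∷ y ∷ []) id r
  two-squares {t} {u} {x} {y} tu xy p q dis
    with remove-square no-reduction q (Admissible.distinct A xy) (λ ()) (λ ())
  ... | _ , ρ , ⊆₁ , ⊇₁
    with remove-square ρ p (Admissible.distinct A tu) (λ t∈ → dis (here refl , swap₂ t∈))
                         (λ u∈ → dis (there (here refl) , swap₂ u∈))
  ... | _ , σ , ⊆₂ , ⊇₂ =
    tips-apart dis (square-tip p (Admissible.distinct A tu)) (square-tip q (Admissible.distinct A xy)) ,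
    square-at tu p , square-at xy q ,
    removal A σ closed id-symmetry (∷⁺ (∷⁺ ⊆₁) ∘ ⊆₂) (⊇₂ ∘ ∷⁺ (∷⁺ ⊇₁))
      (∷⁺ (∷⁺ swap₂) ∘ swap₂) (∷⁺ (∷⁺ swap₂) ∘ swap₂)
      (4∣remaining A σ (subst (4 ∣_)
        (sym (trans (total-square A ut (y ∷ x ∷ [])) (cong (λ w → 2 + w) (total-square A yx [])))) (divides 1 refl)))
    where
    ut = Admissible.symmetric A tu
    yx = Admissible.symmetric A xy
    closed = square-closed A ut (square-closed A yx (λ _ ()))

theorem7p6 : ∀ {m : ℕ} (T : Triangulation m) (a : Labelling T) (A : Admissible T a) →
    (m < 4 × (triangles T ≡ [] ⊎ (∃[ t ] (triangles T ≡ t ∷ [] × a t ≡ 1ℤ))))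
    ⊎ (∃[ k ] ∃[ t ] (TriangleAt T a k t 1ℤ
    × RemovalAdmissible T a (k ∷ []) (t ∷ []) id (m ∸ 1)))
    ⊎ (¬ (2 ∣ m) × (∃[ k ] ∃[ t ] ∃[ u ] ∃[ c ] (SquareAt T a A k t u c
    × RemovalAdmissible T a (k ∷ succ k ∷ []) (t ∷ u ∷ []) -_ (m ∸ 2))))
    ⊎ ((2 ∣ m) × (∃[ k ] ∃[ t ] (TriangleAt T a k t -1ℤ
    × RemovalAdmissible T a (k ∷ []) (t ∷ []) -_ (m ∸ 1))))
    ⊎ (∃[ j ] ∃[ k ] (Apart j k × (∃[ t ] ∃[ u ] ∃[ c ] ∃[ x ] ∃[ y ] ∃[ e ]
    (SquareAt T a A j t u c × SquareAt T a A k x y e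
    × RemovalAdmissible T a (j ∷ succ j ∷ k ∷ succ k ∷ []) (t ∷ u ∷ x ∷ y ∷ []) id (m ∸ 4)))))
    ⊎ (∃[ j ] ∃[ k ] (Apart j k × (∃[ t ] ∃[ u ]
    (TriangleAt T a j t -1ℤ × TriangleAt T a k u -1ℤ
    × RemovalAdmissible T a (j ∷ k ∷ []) (t ∷ u ∷ []) id (m ∸ 2)))))
theorem7p6 {zero} T a A = contradiction (Triangulation.m≥2 T) λ ()
theorem7p6 {suc zero} T a A = contradiction (Triangulation.m≥2 T) λ { (s≤s ()) }
theorem7p6 {suc (suc zero)} T a A = inj₁ (s≤s (s≤s (s≤s z≤n)) , inj₁ (empty (triangles T) (Triangulation.count T)))
  where
  empty : ∀ ts → length ts ≡ 0 → ts ≡ []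
  empty [] _ = refl
theorem7p6 {suc (suc (suc zero))} T a A =
  inj₁ (≤-refl , inj₂ (single-triangle T a A (Triangulation.count T)))
theorem7p6 {suc (suc (suc (suc r)))} T a A with Search.two-leaves T A (s≤s (s≤s (s≤s z≤n)))
... | X , Y , lX , lY , dis = cases lX lY dis (2 ∣? (4 + r))
  where
  open Conclusion T a A
  open Leaves A
  -- A leaf labelled 1 is used first. Then parity decides: a square suffices for odd `m`, an ear
  -- labelled -1 for even `m`. What remains is two squares with `m` even or two such ears with `m`
  -- odd, where both leaves go and no sign changes.
  cases : ∀ {X Y} → Leaf X → Leaf Y → Disjoint X Y → Dec (2 ∣ 4 + r) → _
  cases (ear e (inj₁ p)) _ _ _ = inj₂ (inj₁ (_ , _ , positive-ear e p))
  cases (ear _ (inj₂ _)) (ear f (inj₁ p)) _ _ = inj₂ (inj₁ (_ , _ , positive-ear f p))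
  cases (square _ _) (ear f (inj₁ p)) _ _ = inj₂ (inj₁ (_ , _ , positive-ear f p))
  cases (square sq q) _ _ (no odd) = inj₂ (inj₂ (inj₁ (odd , _ , _ , _ , _ , one-square odd sq q)))
  cases (ear _ (inj₂ _)) (square sq q) _ (no odd) = inj₂ (inj₂ (inj₁ (odd , _ , _ , _ , _ , one-square odd sq q)))
  cases (ear e (inj₂ p)) _ _ (yes even) = inj₂ (inj₂ (inj₂ (inj₁ (even , _ , _ , negative-ear even e p))))
  cases (square _ _) (ear f (inj₂ p)) _ (yes even) = inj₂ (inj₂ (inj₂ (inj₁ (even , _ , _ , negative-ear even f p))))
  cases (square sq q) (square sq′ q′) dis (yes _) with two-squares sq sq′ q q′ dis
  ... | apart , conclusions = inj₂ (inj₂ (inj₂ (inj₂ (inj₁ (_ , _ , apart , _ , _ , _ , _ , _ , _ , conclusions)))))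
  cases (ear e (inj₂ p)) (ear f (inj₂ p′)) dis (no _) with two-ears e f dis p p′
  ... | apart , conclusions = inj₂ (inj₂ (inj₂ (inj₂ (inj₂ (_ , _ , apart , _ , _ , conclusions)))))
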